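{- Given any $\epsilon > 0$, any algorithm achieving a $(2-\epsilon)$-approximation for the Symmetric Submodular $k$-Multiway Partitioning problem (Sym-Sub-$k$-MP) when $k$ is part of the input, requires exponentially many queries in the value oracle model.
   Context: For a finite set $V$, a function $f:2^V\to\mathbb{R}$ is submodular if $f(A\cup\{v\})-f(A)\ge f(B\cup\{v\})-f(B)$ for all $A\subseteq B\subseteq V$ and $v\notin B$; it is symmetric if $f(S)=f(V\setminus S)$ for all $S\subseteq V$. The symbol $\uplus$ denotes the union of disjoint sets and $[k]=\{1,\dots,k\}$. Sym-Sub-$k$-MP: given a non-negative symmetric submodular function $f:2^V\to\mathbb{R}_+$ over a ground set $V$, partition $V$ into $k$ non-empty sets so as to attain $$\min \sum_{i=1}^k f(S_i)\quad\text{s.t. } S_1\uplus S_2\uplus\cdots\uplus S_k=V,\ S_i\neq\emptyset \text{ for all } i\in[k].$$ Value oracle model: $f$ is accessed through an oracle that returns $f(S)$ for a given set $S\subseteq V$. Hardness results in this model are information-theoretic: they are limits on the approximability of a problem when only polynomially many queries to the value oracle are allowed. An algorithm achieves an $\alpha$-approximation if it outputs a feasible $(S_1,\dots,S_k)$ with $\sum_i f(S_i)$ at most $\alpha$ times the optimal value. -}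

module Defs where

open import Data.Fin.Base using (Fin)
open import Data.Fin.Subset using (Subset; _∈_; _∉_; _⊆_; _∪_; ∁; ⁅_⁆; Nonempty)
open import Data.Integer.Base using (+_)
open import Data.Nat.Base as ℕ using (ℕ; suc)
import Data.Nat.Properties as ℕ
open import Data.Product.Base using (∃; ∃-syntax; _×_; _,_)
open import Data.Rational.Base
  using (ℚ; 0ℚ; 1ℚ; ½; _+_; _*_; -_; _-_; _/_; 1/_; ∣_∣; _≤_; _<_; Positive; positive)
open import Data.Rational.Properties
open import Data.Rational.Solver using (module +-*-Solver)
open import Data.Vec.Functional using (Vector; foldr; map)
open import Relation.Binary.PropositionalEquality
  using (_≡_; refl; sym; trans; cong; cong₂; subst)

------------------------------------------------------------------------
-- Real numbers, as Cauchy sequences of rationals with modulus. Equality is _≈ℝ_;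
-- propositional equality distinguishes representatives.

IsCauchy : (ℕ → ℚ) → Set
IsCauchy x = ∀ δ → 0ℚ < δ →
  ∃[ N ] (∀ m n → N ℕ.≤ m → N ℕ.≤ n → ∣ x m - x n ∣ < δ)

record ℝ : Set where
  constructor mkℝ
  field
    seq    : ℕ → ℚ
    cauchy : IsCauchy seq

open ℝ public

infix 4 _≤ℝ_ _<ℝ_ _≈ℝ_

_≤ℝ_ : ℝ → ℝ → Set
x ≤ℝ y = ∀ δ → 0ℚ < δ → ∃[ N ] (∀ n → N ℕ.≤ n → seq x n ≤ seq y n + δ)

_<ℝ_ : ℝ → ℝ → Set
x <ℝ y = ∃[ δ ] 0ℚ < δ × ∃[ N ] (∀ n → N ℕ.≤ n → seq x n + δ ≤ seq y n)

_≈ℝ_ : ℝ → ℝ → Set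
x ≈ℝ y = x ≤ℝ y × y ≤ℝ x

private
  abstract
    0<½*δ : ∀ {δ} → 0ℚ < δ → 0ℚ < ½ * δ
    0<½*δ {δ} 0<δ = positive⁻¹ (½ * δ) {{pos*pos⇒pos ½ δ {{positive 0<δ}}}}

    ½+½ : ∀ δ → ½ * δ + ½ * δ ≡ δ
    ½+½ δ = trans (sym (*-distribʳ-+ δ ½ ½)) (*-identityˡ δ)

    const-cauchy : ∀ p → IsCauchy (λ _ → p)
    const-cauchy p δ 0<δ = 0 , λ _ _ _ _ → subst (_< δ) (sym (cong ∣_∣ (+-inverseʳ p))) 0<δ

    +-cauchy : ∀ x y → IsCauchy (seq x) → IsCauchy (seq y) →
               IsCauchy (λ n → seq x n + seq y n)
    +-cauchy x y cx cy δ 0<δ with cx (½ * δ) (0<½*δ 0<δ) | cy (½ * δ) (0<½*δ 0<δ)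
    ... | N , p | M , q = N ℕ.⊔ M , λ m n m≥ n≥ → begin-strict
      ∣ (seq x m + seq y m) - (seq x n + seq y n) ∣
        ≡⟨ cong ∣_∣ (rearrange (seq x m) (seq y m) (seq x n) (seq y n)) ⟩
      ∣ (seq x m - seq x n) + (seq y m - seq y n) ∣
        ≤⟨ ∣p+q∣≤∣p∣+∣q∣ (seq x m - seq x n) (seq y m - seq y n) ⟩
      ∣ seq x m - seq x n ∣ + ∣ seq y m - seq y n ∣
        <⟨ +-mono-< (p m n (ℕ.m⊔n≤o⇒m≤o N M m≥) (ℕ.m⊔n≤o⇒m≤o N M n≥))
                    (q m n (ℕ.m⊔n≤o⇒n≤o N M m≥) (ℕ.m⊔n≤o⇒n≤o N M n≥)) ⟩
      ½ * δ + ½ * δ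
        ≡⟨ ½+½ δ ⟩
      δ ∎
      where
      open ≤-Reasoning
      rearrange : ∀ a b c d → (a + b) - (c + d) ≡ (a - c) + (b - d)
      rearrange = solve 4 (λ a b c d → (a :+ b) :- (c :+ d) := (a :- c) :+ (b :- d)) refl
        where open +-*-Solver

    neg-cauchy : ∀ x → IsCauchy (seq x) → IsCauchy (λ n → - seq x n)
    neg-cauchy x cx δ 0<δ with cx δ 0<δ
    ... | N , p = N , λ m n m≥ n≥ → subst (_< δ)
      (trans (sym (∣-p∣≡∣p∣ (seq x m - seq x n)))
             (cong ∣_∣ (neg-distrib-+ (seq x m) (- seq x n))))
      (p m n m≥ n≥)

    eventuallyBounded : ∀ x → ∃[ B ] 0ℚ < B × ∃[ N ] (∀ n → N ℕ.≤ n → ∣ seq x n ∣ ≤ B)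
    eventuallyBounded x with cauchy x 1ℚ (positive⁻¹ 1ℚ)
    ... | N , p =
      1ℚ + ∣ seq x N ∣ ,
      positive⁻¹ (1ℚ + ∣ seq x N ∣) {{pos+nonNeg⇒pos 1ℚ ∣ seq x N ∣ {{∣-∣-nonNeg (seq x N)}}}} ,
      N , λ n n≥ → begin
        ∣ seq x n ∣
          ≡⟨ cong ∣_∣ (insert (seq x n) (seq x N)) ⟩
        ∣ (seq x n - seq x N) + seq x N ∣
          ≤⟨ ∣p+q∣≤∣p∣+∣q∣ (seq x n - seq x N) (seq x N) ⟩
        ∣ seq x n - seq x N ∣ + ∣ seq x N ∣
          ≤⟨ +-monoˡ-≤ ∣ seq x N ∣ (<⇒≤ (p n N n≥ ℕ.≤-refl)) ⟩
        1ℚ + ∣ seq x N ∣ ∎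
      where
      open ≤-Reasoning
      insert : ∀ a b → a ≡ (a - b) + b
      insert = solve 2 (λ a b → a := (a :- b) :+ b) refl
        where open +-*-Solver

    divideBy : ∀ B {{_ : Positive B}} δ → 0ℚ < δ → ∃[ η ] 0ℚ < η × B * η ≡ δ
    divideBy B δ 0<δ =
      1/B * δ ,
      positive⁻¹ (1/B * δ) {{pos*pos⇒pos 1/B {{1/pos⇒pos B}} δ {{positive 0<δ}}}} ,
      trans (sym (*-assoc B 1/B δ))
        (trans (cong (_* δ) (*-inverseʳ B {{pos⇒nonZero B}})) (*-identityˡ δ))
      where
      1/B : ℚ
      1/B = (1/ B) {{pos⇒nonZero B}}

    ∣p*q∣<δ : ∀ {B η δ} p q → 0ℚ < B → B * η ≡ δ → ∣ p ∣ ≤ B → ∣ q ∣ < η → ∣ p * q ∣ < δ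
    ∣p*q∣<δ {B} {η} {δ} p q 0<B eq p≤ q< = begin-strict
      ∣ p * q ∣      ≡⟨ ∣p*q∣≡∣p∣*∣q∣ p q ⟩
      ∣ p ∣ * ∣ q ∣  ≤⟨ *-monoʳ-≤-nonNeg ∣ q ∣ {{∣-∣-nonNeg q}} p≤ ⟩
      B * ∣ q ∣      <⟨ *-monoʳ-<-pos B {{positive 0<B}} q< ⟩
      B * η          ≡⟨ eq ⟩
      δ              ∎
      where open ≤-Reasoning

    *-close : ∀ {A B η θ δ} a b c d → 0ℚ < A → 0ℚ < B → A * η ≡ ½ * δ → B * θ ≡ ½ * δ →
              ∣ a ∣ ≤ A → ∣ d ∣ ≤ B → ∣ b - d ∣ < η → ∣ a - c ∣ < θ →
              ∣ a * b - c * d ∣ < δ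
    *-close {δ = δ} a b c d 0<A 0<B Aη Bθ a≤A d≤B b-d a-c = begin-strict
      ∣ a * b - c * d ∣                  ≡⟨ cong ∣_∣ (rearrange a b c d) ⟩
      ∣ a * (b - d) + d * (a - c) ∣      ≤⟨ ∣p+q∣≤∣p∣+∣q∣ (a * (b - d)) (d * (a - c)) ⟩
      ∣ a * (b - d) ∣ + ∣ d * (a - c) ∣  <⟨ +-mono-< (∣p*q∣<δ a (b - d) 0<A Aη a≤A b-d)
                                                     (∣p*q∣<δ d (a - c) 0<B Bθ d≤B a-c) ⟩
      ½ * δ + ½ * δ                      ≡⟨ ½+½ δ ⟩
      δ                                  ∎
      where
      open ≤-Reasoning
      rearrange : ∀ a b c d → a * b - c * d ≡ a * (b - d) + d * (a - c)
      rearrange = solve 4 (λ a b c d →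
        a :* b :- c :* d := a :* (b :- d) :+ d :* (a :- c)) refl
        where open +-*-Solver

    *-cauchy : ∀ x y → IsCauchy (λ n → seq x n * seq y n)
    *-cauchy x y δ 0<δ =
      let A , 0<A , K , x≤A = eventuallyBounded x
          B , 0<B , L , y≤B = eventuallyBounded y
          η , 0<η , Aη      = divideBy A {{positive 0<A}} (½ * δ) (0<½*δ 0<δ)
          θ , 0<θ , Bθ      = divideBy B {{positive 0<B}} (½ * δ) (0<½*δ 0<δ)
          M , q             = cauchy y η 0<η
          N , p             = cauchy x θ 0<θ
      in (K ℕ.⊔ L) ℕ.⊔ (M ℕ.⊔ N) , λ m n m≥ n≥ →
      let m≥KL = ℕ.m⊔n≤o⇒m≤o (K ℕ.⊔ L) (M ℕ.⊔ N) m≥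
          m≥MN = ℕ.m⊔n≤o⇒n≤o (K ℕ.⊔ L) (M ℕ.⊔ N) m≥
          n≥KL = ℕ.m⊔n≤o⇒m≤o (K ℕ.⊔ L) (M ℕ.⊔ N) n≥
          n≥MN = ℕ.m⊔n≤o⇒n≤o (K ℕ.⊔ L) (M ℕ.⊔ N) n≥
      in *-close (seq x m) (seq y m) (seq x n) (seq y n) 0<A 0<B Aη Bθ
           (x≤A m (ℕ.m⊔n≤o⇒m≤o K L m≥KL))
           (y≤B n (ℕ.m⊔n≤o⇒n≤o K L n≥KL))
           (q m n (ℕ.m⊔n≤o⇒m≤o M N m≥MN) (ℕ.m⊔n≤o⇒m≤o M N n≥MN))
           (p m n (ℕ.m⊔n≤o⇒n≤o M N m≥MN) (ℕ.m⊔n≤o⇒n≤o M N n≥MN))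

fromℚ : ℚ → ℝ
fromℚ p = mkℝ (λ _ → p) (const-cauchy p)

0ℝ 2ℝ : ℝ
0ℝ = fromℚ 0ℚ
2ℝ = fromℚ (+ 2 / 1)

infixl 6 _+ℝ_ _-ℝ_
infixl 7 _*ℝ_

_+ℝ_ : ℝ → ℝ → ℝ
x +ℝ y = mkℝ (λ n → seq x n + seq y n) (+-cauchy x y (cauchy x) (cauchy y))

-ℝ_ : ℝ → ℝ
-ℝ x = mkℝ (λ n → - seq x n) (neg-cauchy x (cauchy x))

_-ℝ_ : ℝ → ℝ → ℝ
x -ℝ y = x +ℝ (-ℝ y)

_*ℝ_ : ℝ → ℝ → ℝ
x *ℝ y = mkℝ (λ n → seq x n * seq y n) (*-cauchy x y)

------------------------------------------------------------------------
-- Symmetric submodular set functions on the ground set Fin n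

SetFunction : ℕ → Set
SetFunction n = Subset n → ℝ

module _ {n : ℕ} (f : SetFunction n) where

  NonNegative : Set
  NonNegative = ∀ S → 0ℝ ≤ℝ f S

  Symmetric : Set
  Symmetric = ∀ S → f S ≈ℝ f (∁ S)

  Submodular : Set
  Submodular = ∀ A B v → A ⊆ B → v ∉ B →
    f (B ∪ ⁅ v ⁆) -ℝ f B ≤ℝ f (A ∪ ⁅ v ⁆) -ℝ f A

  record IsInstance : Set where
    field
      nonNegative : NonNegative
      symmetric   : Symmetric
      submodular  : Submodular

------------------------------------------------------------------------
-- Sym-Sub-k-MP

record IsPartition {n k : ℕ} (S : Vector (Subset n) k) : Set where
  field
    nonempty : ∀ i → Nonempty (S i)
    disjoint : ∀ {i j v} → v ∈ S i → v ∈ S j → i ≡ j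
    covers   : ∀ v → ∃[ i ] v ∈ S i

cost : ∀ {n k} → SetFunction n → Vector (Subset n) k → ℝ
cost f S = foldr _+ℝ_ 0ℝ (map f S)

record IsOptimal {n k : ℕ} (f : SetFunction n) (S : Vector (Subset n) k) : Set where
  field
    feasible : IsPartition S
    minimal  : ∀ (T : Vector (Subset n) k) → IsPartition T → cost f S ≤ℝ cost f T

------------------------------------------------------------------------
-- The value oracle model

-- An adaptive algorithm, for given n and k, as a decision tree: it either
-- stops with a k-tuple of sets or queries a set and continues depending on the
-- answer. Computation between queries is unrestricted. Answers are
-- representatives of reals, and the continuation need not respect _≈ℝ_, so
-- this only enlarges the class of algorithms.
data Tree (n k : ℕ) : Set where
  output : Vector (Subset n) k → Tree n k
  query  : Subset n → (ℝ → Tree n k) → Tree n k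

run : ∀ {n k} → SetFunction n → Tree n k → Vector (Subset n) k
run f (output S)  = S
run f (query S c) = run f (c (f S))

queries : ∀ {n k} → SetFunction n → Tree n k → ℕ
queries f (output S)  = 0
queries f (query S c) = suc (queries f (c (f S)))

-- k is part of the input, as is the size of the ground set.
Algorithm : Set
Algorithm = ∀ n k → Tree n k

-- The problem is feasible exactly when 1 ≤ k ≤ n (or n = k = 0, not considered).
Approximates : ℝ → Algorithm → Set
Approximates α alg = ∀ n k → 1 ℕ.≤ k → k ℕ.≤ n → (f : SetFunction n) → IsInstance f →
  IsPartition (run f (alg n k)) ×
  (∀ (T : Vector (Subset n) k) → IsOptimal f T →
     cost f (run f (alg n k)) ≤ℝ α *ℝ cost f T)

-- Worst-case query complexity 2^Ω(n): the number q of queries satisfies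
-- 2 ^ n ≤ q ^ C, that is q ≥ 2^(n/C), on some instance of every large size n,
-- with C and n₀ uniform over the class P of algorithms.
RequiresExponentiallyManyQueries : (Algorithm → Set) → Set
RequiresExponentiallyManyQueries P = ∃[ C ] ∃[ n₀ ] (∀ alg → P alg →
  ∀ n → n₀ ℕ.≤ n → ∃[ k ] 1 ℕ.≤ k × k ℕ.≤ n ×
  ∃[ f ] IsInstance f × 2 ℕ.^ n ℕ.≤ queries {n} {k} f (alg n k) ℕ.^ C)

{-# OPTIONS --safe #-}
module Submission where

-- Put p = k − 1, q = n − p and φ(s) = pq · s(n − s). For S ↦ φ(|S|), a multiple of
-- the cut function of the complete graph, every k-partition costs at least
-- pq (p(n − 1) + pq). A hidden set H of p elements changes the value to
-- φ(|S|) − ψ(q|S ∩ H| − p|S ∖ H|), where ψ(x) is the squared distance from x to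
-- [−g, g]: the mixed second differences of ψ lie between 0 and 2hk, so that the
-- strict concavity of φ absorbs them, and the function stays submodular. Now ∁H and
-- the singletons of H cost at most pq (p(n − 1) + 2g), which for p ≪ n and g ≪ pn is
-- smaller by a factor close to 2. The two functions agree on every set S with
-- |S ∩ H| ≈ (p/n)|S|. Picking H as one element from each of p blocks of L elements,
-- by conditional expectations of an exponential weight, makes this hold for all
-- sets in any list of subexponential length, in particular for the queries made on
-- the function without H and the parts then returned. On the function with H the
-- algorithm therefore returns the same partition, whose cost did not drop.

open import Defs

-- Squared distance to an interval: convexity and smoothness

module DeadZones where

  open import Data.Integer.Base
  open import Data.Integer.Properties
  open import Data.Integer.Tactic.RingSolver using (solve-∀)
  open import Data.Nat.Base as ℕ using (ℕ)
  open import Data.Product.Base using (_×_; _,_; proj₁; proj₂)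
  open import Data.Sum.Base using (_⊎_; inj₁; inj₂)
  open import Relation.Binary.PropositionalEquality

  *-nonneg : ∀ {i j} → 0ℤ ≤ i → 0ℤ ≤ j → 0ℤ ≤ i * j
  *-nonneg {i} {j} 0≤i 0≤j =
    subst (_≤ i * j) (*-zeroʳ i) (*-monoˡ-≤-nonNeg i {{nonNegative 0≤i}} 0≤j)

  -- Splits an integer inequality into a certificate `d` that is visibly nonnegative and an identity
  -- for the ring solver.
  ≤-by : ∀ {i j} d → 0ℤ ≤ d → d ≡ j - i → i ≤ j
  ≤-by d 0≤d eq = 0≤i-j⇒j≤i (subst (0ℤ ≤_) eq 0≤d)

  square-nonneg : ∀ i → 0ℤ ≤ i * i
  square-nonneg (+ i)    = subst (0ℤ ≤_) (pos-* i i) (+≤+ ℕ.z≤n)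
  square-nonneg -[1+ i ] = +≤+ ℕ.z≤n

  square-mono : ∀ {i j} → 0ℤ ≤ i → i ≤ j → i * i ≤ j * j
  square-mono {i} {j} 0≤i i≤j =
    ≤-by ((j - i) * (i + j)) (*-nonneg (i≤j⇒0≤j-i i≤j) (+-mono-≤ 0≤i (≤-trans 0≤i i≤j))) (eq i j)
    where
    eq : ∀ i j → (j - i) * (i + j) ≡ j * j - i * i
    eq = solve-∀

  module DeadZone (g : ℕ) where

    clamp : ℤ → ℤ
    clamp x = (- + g) ⊔ (+ g ⊓ x)

    ψ : ℤ → ℤ
    ψ x = (x - clamp x) * (x - clamp x)

    InZone : ℤ → Set
    InZone x = - + g ≤ x × x ≤ + g

    -g≤g : - + g ≤ + g
    -g≤g = ≤-trans neg-≤-pos ≤-refl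

    clamp-inZone : ∀ x → InZone (clamp x)
    clamp-inZone x = i≤i⊔j (- + g) _ , ⊔-lub -g≤g (i⊓j≤i (+ g) x)

    clamp-id : ∀ {x} → InZone x → clamp x ≡ x
    clamp-id (lo , hi) = trans (cong (_ ⊔_) (i≥j⇒i⊓j≡j hi)) (i≤j⇒i⊔j≡j lo)

    clamp-above : ∀ {x} → + g ≤ x → clamp x ≡ + g
    clamp-above hi = trans (cong (_ ⊔_) (i≤j⇒i⊓j≡i hi)) (i≤j⇒i⊔j≡j -g≤g)

    clamp-below : ∀ {x} → x ≤ - + g → clamp x ≡ - + g
    clamp-below {x} lo = i≥j⇒i⊔j≡i (≤-trans (i⊓j≤j (+ g) x) lo)

    clamp-mono : ∀ {x y} → x ≤ y → clamp x ≤ clamp y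
    clamp-mono x≤y = ⊔-mono-≤ ≤-refl (⊓-mono-≤ ≤-refl x≤y)

    clamp-neg : ∀ x → clamp (- x) ≡ - clamp x
    clamp-neg x = go (≤-total x (+ g)) (≤-total (- + g) x)
      where
      go : x ≤ + g ⊎ + g ≤ x → - + g ≤ x ⊎ x ≤ - + g → clamp (- x) ≡ - clamp x
      go (inj₁ hi) (inj₁ lo) = trans
        (clamp-id (neg-mono-≤ hi , subst (- x ≤_) (neg-involutive (+ g)) (neg-mono-≤ lo)))
        (cong -_ (sym (clamp-id (lo , hi))))
      go (inj₂ hi) _ = trans (clamp-below (neg-mono-≤ hi)) (cong -_ (sym (clamp-above hi)))
      go _ (inj₂ lo) = trans
        (clamp-above (subst (_≤ - x) (neg-involutive (+ g)) (neg-mono-≤ lo)))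
        (trans (sym (neg-involutive (+ g))) (cong -_ (sym (clamp-below lo))))

    ψ-even : ∀ x → ψ (- x) ≡ ψ x
    ψ-even x = trans (cong (λ c → (- x - c) * (- x - c)) (clamp-neg x)) (eq x (clamp x))
      where
      eq : ∀ x c → (- x - - c) * (- x - - c) ≡ (x - c) * (x - c)
      eq = solve-∀

    ψ-zero : ∀ {x} → InZone x → ψ x ≡ 0ℤ
    ψ-zero {x} z = trans (cong (λ c → (x - c) * (x - c)) (clamp-id z)) (eq x)
      where
      eq : ∀ x → (x - x) * (x - x) ≡ 0ℤ
      eq = solve-∀

    -- The clamped point is the nearest one in the zone, so each `y` in the zone is a competitor.
    -- The two second-difference estimates below need only exhibit good competitors.
    ψ-least : ∀ x {y} → InZone y → ψ x ≤ (x - y) * (x - y)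
    ψ-least x {y} (lo , hi) = go (≤-total x (+ g)) (≤-total (- + g) x)
      where
      swap : ∀ a b → (a - b) * (a - b) ≡ (b - a) * (b - a)
      swap = solve-∀
      go : x ≤ + g ⊎ + g ≤ x → - + g ≤ x ⊎ x ≤ - + g → ψ x ≤ (x - y) * (x - y)
      go (inj₁ x≤g) (inj₁ -g≤x) = subst (_≤ (x - y) * (x - y)) (sym (ψ-zero (-g≤x , x≤g))) (square-nonneg (x - y))
      go (inj₂ g≤x) _ rewrite clamp-above g≤x =
        square-mono (i≤j⇒0≤j-i g≤x) (+-monoʳ-≤ x (neg-mono-≤ hi))
      go _ (inj₂ x≤-g) rewrite clamp-below x≤-g | swap x (- + g) | swap x y =
        square-mono (i≤j⇒0≤j-i x≤-g) (+-monoˡ-≤ (- x) lo)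

    -- The points of [−g, g] nearest to x and x + h + k are moved towards each other
    -- to give competitors for x + h and x + k.
    ψ-convex : ∀ x h k → 0ℤ ≤ h → 0ℤ ≤ k → ψ (x + h) + ψ (x + k) ≤ ψ x + ψ (x + h + k)
    ψ-convex x h k 0≤h 0≤k = go (≤-total d h)
      where
      c₀ c₃ d : ℤ
      c₀ = clamp x
      c₃ = clamp (x + h + k)
      d  = c₃ - c₀
      c₀≤c₃ : c₀ ≤ c₃
      c₀≤c₃ = clamp-mono (≤-by (h + k) (+-mono-≤ 0≤h 0≤k) (eq x h k))
        where
        eq : ∀ x h k → h + k ≡ x + h + k - x
        eq = solve-∀
      in₀ = clamp-inZone x
      in₃ = clamp-inZone (x + h + k)
      go : d ≤ h ⊎ h ≤ d → ψ (x + h) + ψ (x + k) ≤ ψ x + ψ (x + h + k)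
      go (inj₁ d≤h) = ≤-trans (+-mono-≤ (ψ-least (x + h) in₃) (ψ-least (x + k) in₀))
        (≤-by ((k + k) * (h - d)) (*-nonneg (+-mono-≤ 0≤k 0≤k) (i≤j⇒0≤j-i d≤h)) (eq x h k c₀ c₃))
        where
        eq : ∀ x h k c₀ c₃ → (k + k) * (h - (c₃ - c₀)) ≡
          (x - c₀) * (x - c₀) + (x + h + k - c₃) * (x + h + k - c₃)
          - ((x + h - c₃) * (x + h - c₃) + (x + k - c₀) * (x + k - c₀))
        eq = solve-∀
      go (inj₂ h≤d) = ≤-trans (+-mono-≤ (ψ-least (x + h) in₁) (ψ-least (x + k) in₂))
        (≤-reflexive (eq x h k c₀ c₃))
        where
        eq₁ : ∀ c₀ c₃ h → (c₃ - c₀) - h ≡ c₃ - (c₀ + h)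
        eq₁ = solve-∀
        eq₂ : ∀ c₃ h → h ≡ c₃ - (c₃ - h)
        eq₂ = solve-∀
        eq₃ : ∀ c₀ c₃ h → (c₃ - c₀) - h ≡ (c₃ - h) - c₀
        eq₃ = solve-∀
        eq₄ : ∀ c₀ h → h ≡ c₀ + h - c₀
        eq₄ = solve-∀
        in₁ : InZone (c₀ + h)
        in₁ = ≤-trans (proj₁ in₀) (≤-by h 0≤h (eq₄ c₀ h)) ,
              ≤-trans (≤-by (d - h) (i≤j⇒0≤j-i h≤d) (eq₁ c₀ c₃ h)) (proj₂ in₃)
        in₂ : InZone (c₃ - h)
        in₂ = ≤-trans (proj₁ in₀) (≤-by (d - h) (i≤j⇒0≤j-i h≤d) (eq₃ c₀ c₃ h)) ,
              ≤-trans (≤-by h 0≤h (eq₂ c₃ h)) (proj₂ in₃)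
        eq : ∀ x h k c₀ c₃ →
          (x + h - (c₀ + h)) * (x + h - (c₀ + h)) + (x + k - (c₃ - h)) * (x + k - (c₃ - h)) ≡
          (x - c₀) * (x - c₀) + (x + h + k - c₃) * (x + h + k - c₃)
        eq = solve-∀

    -- For fixed `c` the mixed second difference of `(x - c)²` is `2hk`. The nearest points of
    -- `x + h` and `x + k` compete for `x` and `x + h + k`, the smaller one going to `x`; in this
    -- order the remaining error has the favourable sign.
    ψ-smooth : ∀ x h k → 0ℤ ≤ h → 0ℤ ≤ k →
               ψ x + ψ (x + h + k) ≤ ψ (x + h) + ψ (x + k) + + 2 * (h * k)
    ψ-smooth x h k 0≤h 0≤k = go (≤-total c₁ c₂)
      where
      c₁ c₂ : ℤ
      c₁ = clamp (x + h)
      c₂ = clamp (x + k)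
      in₁ = clamp-inZone (x + h)
      in₂ = clamp-inZone (x + k)
      go : c₁ ≤ c₂ ⊎ c₂ ≤ c₁ → ψ x + ψ (x + h + k) ≤ ψ (x + h) + ψ (x + k) + + 2 * (h * k)
      go (inj₁ c₁≤c₂) = ≤-trans (+-mono-≤ (ψ-least x in₁) (ψ-least (x + h + k) in₂))
        (≤-by ((h + h) * (c₂ - c₁)) (*-nonneg (+-mono-≤ 0≤h 0≤h) (i≤j⇒0≤j-i c₁≤c₂)) (eq x h k c₁ c₂))
        where
        eq : ∀ x h k c₁ c₂ → (h + h) * (c₂ - c₁) ≡
          (x + h - c₁) * (x + h - c₁) + (x + k - c₂) * (x + k - c₂) + + 2 * (h * k)
          - ((x - c₁) * (x - c₁) + (x + h + k - c₂) * (x + h + k - c₂))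
        eq = solve-∀
      go (inj₂ c₂≤c₁) = ≤-trans (+-mono-≤ (ψ-least x in₂) (ψ-least (x + h + k) in₁))
        (≤-by ((k + k) * (c₁ - c₂)) (*-nonneg (+-mono-≤ 0≤k 0≤k) (i≤j⇒0≤j-i c₂≤c₁)) (eq x h k c₁ c₂))
        where
        eq : ∀ x h k c₁ c₂ → (k + k) * (c₁ - c₂) ≡
          (x + h - c₁) * (x + h - c₁) + (x + k - c₂) * (x + k - c₂) + + 2 * (h * k)
          - ((x - c₂) * (x - c₂) + (x + h + k - c₁) * (x + h + k - c₁))
        eq = solve-∀

-- The function with a hidden set is symmetric and submodular

module HardFunctions where

  open DeadZones
  open import Data.Fin.Base using (Fin; zero; suc)
  open import Data.Fin.Subset using (Subset; inside; outside; _∈_; _∉_; _⊆_; _∩_; _∪_; ∁; ⁅_⁆) renaming (∣_∣ to card)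
  open import Data.Fin.Subset.Properties
  open import Data.Integer.Base hiding (suc)
  open import Data.Integer.Properties
  open import Data.Integer.Tactic.RingSolver using (solve-∀)
  open import Data.Nat.Base as ℕ using (ℕ; suc)
  import Data.Nat.Properties as ℕ
  open import Data.Product.Base using (_,_)
  open import Data.Vec.Base using ([]; _∷_; here; there)
  open import Relation.Binary.PropositionalEquality
  open import Relation.Nullary using (contradiction; yes; no)

  card-∩-∁ : ∀ {n} (S H : Subset n) → card (∁ S ∩ H) ℕ.+ card (S ∩ H) ≡ card H
  card-∩-∁ []            []            = refl
  card-∩-∁ (inside  ∷ S) (inside  ∷ H) = trans (ℕ.+-suc _ _) (cong suc (card-∩-∁ S H))
  card-∩-∁ (inside  ∷ S) (outside ∷ H) = card-∩-∁ S H
  card-∩-∁ (outside ∷ S) (inside  ∷ H) = cong suc (card-∩-∁ S H)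
  card-∩-∁ (outside ∷ S) (outside ∷ H) = card-∩-∁ S H

  card-split : ∀ {n} (S H : Subset n) → card (S ∩ ∁ H) ℕ.+ card (S ∩ H) ≡ card S
  card-split S H = trans
    (cong₂ ℕ._+_ (cong card (∩-comm S (∁ H))) (cong card (∩-comm S H))) (card-∩-∁ H S)

  card-∁ : ∀ {n} (S : Subset n) → card (∁ S) ℕ.+ card S ≡ n
  card-∁ S = trans (cong (λ k → k ℕ.+ card S) (∣∁p∣≡n∸∣p∣ S)) (ℕ.m∸n+n≡m (∣p∣≤n S))

  card-insert-∈ : ∀ {n} {v} (S H : Subset n) → v ∉ S → v ∈ H →
                  card ((S ∪ ⁅ v ⁆) ∩ H) ≡ suc (card (S ∩ H))
  card-insert-∈ (inside ∷ S)  (inside ∷ H)  v∉S here = contradiction here v∉S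
  card-insert-∈ (outside ∷ S) (inside ∷ H)  v∉S here =
    cong (λ T → suc (card (T ∩ H))) (∪-identityʳ S)
  card-insert-∈ (x ∷ S) (y ∷ H) v∉S (there v∈H) with card-insert-∈ S H (λ v∈S → v∉S (there v∈S)) v∈H
  card-insert-∈ (inside  ∷ S) (inside  ∷ H) v∉S (there v∈H) | eq = cong suc eq
  card-insert-∈ (inside  ∷ S) (outside ∷ H) v∉S (there v∈H) | eq = eq
  card-insert-∈ (outside ∷ S) (inside  ∷ H) v∉S (there v∈H) | eq = eq
  card-insert-∈ (outside ∷ S) (outside ∷ H) v∉S (there v∈H) | eq = eq

  card-insert-∉ : ∀ {n} (v : Fin n) (S H : Subset n) → v ∉ H →
                  card ((S ∪ ⁅ v ⁆) ∩ H) ≡ card (S ∩ H)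
  card-insert-∉ zero    (x ∷ S) (inside ∷ H)  v∉H = contradiction here v∉H
  card-insert-∉ zero    (inside  ∷ S) (outside ∷ H) v∉H = cong (λ T → card (T ∩ H)) (∪-identityʳ S)
  card-insert-∉ zero    (outside ∷ S) (outside ∷ H) v∉H = cong (λ T → card (T ∩ H)) (∪-identityʳ S)
  card-insert-∉ (suc v) (x ∷ S) (y ∷ H) v∉H with card-insert-∉ v S H (λ v∈H → v∉H (there v∈H))
  card-insert-∉ (suc v) (inside  ∷ S) (inside  ∷ H) v∉H | eq = cong suc eq
  card-insert-∉ (suc v) (inside  ∷ S) (outside ∷ H) v∉H | eq = eq
  card-insert-∉ (suc v) (outside ∷ S) (inside  ∷ H) v∉H | eq = eq
  card-insert-∉ (suc v) (outside ∷ S) (outside ∷ H) v∉H | eq = eq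

  card-∩-mono : ∀ {n} {A B : Subset n} (H : Subset n) → A ⊆ B → card (A ∩ H) ℕ.≤ card (B ∩ H)
  card-∩-mono {A = A} {B} H A⊆B = p⊆q⇒∣p∣≤∣q∣ λ x∈ →
    let x∈A , x∈H = x∈p∩q⁻ A H x∈ in x∈p∩q⁺ (A⊆B x∈A , x∈H)

  φ : ℕ → ℕ → ℤ → ℤ
  φ p q s = + p * + q * (s * (+ p + + q - s))

  module Profile (g p q : ℕ) where
    open DeadZone g

    P Q : ℤ
    P = + p
    Q = + q

    -- For `a = |S ∖ H|` and `b = |S ∩ H|` this is `(p + q) b − p (a + b)`: it vanishes when `H`
    -- takes its proportional share of `S`.
    dev : ℤ → ℤ → ℤ
    dev a b = Q * b - P * a

    G : ℤ → ℤ → ℤ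
    G a b = φ p q (a + b) - ψ (dev a b)

    0≤P : 0ℤ ≤ P
    0≤P = +≤+ ℕ.z≤n
    0≤Q : 0ℤ ≤ Q
    0≤Q = +≤+ ℕ.z≤n

    zero-inZone : InZone 0ℤ
    zero-inZone = neg-≤-pos , +≤+ ℕ.z≤n

    -- φ (a + b) − dev² is a weighted cut function of two disjoint cliques.
    G-nonneg : ∀ {a b} → 0ℤ ≤ a → a ≤ Q → 0ℤ ≤ b → b ≤ P → 0ℤ ≤ G a b
    G-nonneg {a} {b} 0≤a a≤Q 0≤b b≤P = ≤-trans
      (*-nonneg (+-mono-≤ 0≤P 0≤Q)
        (+-mono-≤ (*-nonneg (*-nonneg 0≤Q 0≤b) (i≤j⇒0≤j-i b≤P))
                  (*-nonneg (*-nonneg 0≤P 0≤a) (i≤j⇒0≤j-i a≤Q))))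
      (≤-trans (≤-reflexive (eq P Q a b))
               (+-monoʳ-≤ (φ p q (a + b)) (neg-mono-≤ (ψ-least (dev a b) zero-inZone))))
      where
      eq : ∀ P Q a b → (P + Q) * (Q * b * (P - b) + P * a * (Q - a)) ≡
           P * Q * ((a + b) * (P + Q - (a + b))) - (Q * b - P * a - 0ℤ) * (Q * b - P * a - 0ℤ)
      eq = solve-∀

    -- Complementation fixes the `φ` term and negates the deviation, and `ψ` is even. `P` and `Q`
    -- are replaced by the sums so that pure ring identities remain.
    G-sym : ∀ {a b a' b'} → a' + a ≡ Q → b' + b ≡ P → G a' b' ≡ G a b
    G-sym {a} {b} {a'} {b'} a+ b+ = cong₂ _-_
      (trans (cong₂ (λ P Q → P * Q * ((a' + b') * (P + Q - (a' + b')))) (sym b+) (sym a+))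
        (trans (eq₁ a a' b b') (cong₂ (λ P Q → P * Q * ((a + b) * (P + Q - (a + b)))) b+ a+)))
      (trans (cong ψ (trans (cong₂ (λ P Q → Q * b' - P * a') (sym b+) (sym a+))
               (trans (eq₂ a a' b b') (cong₂ (λ P Q → - (Q * b - P * a)) b+ a+))))
             (ψ-even (dev a b)))
      where
      eq₁ : ∀ a a' b b' → (b' + b) * (a' + a) * ((a' + b') * (b' + b + (a' + a) - (a' + b'))) ≡
                          (b' + b) * (a' + a) * ((a + b) * (b' + b + (a' + a) - (a + b)))
      eq₁ = solve-∀
      eq₂ : ∀ a a' b b' → (a' + a) * b' - (b' + b) * a' ≡ - ((a' + a) * b - (b' + b) * a)
      eq₂ = solve-∀

    -- Move from `x` left to `z = x - k`, then right by `l`. By smoothness at `z` the increment over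
    -- `h` loses at most `2hk` on the way left; by convexity at `z` it only grows on the way right.
    ψ-slope : ∀ x h k l → 0ℤ ≤ h → 0ℤ ≤ k → 0ℤ ≤ l →
              ψ (x + h) - ψ x ≤ ψ (x - k + l + h) - ψ (x - k + l) + + 2 * (h * k)
    ψ-slope x h k l 0≤h 0≤k 0≤l = ≤-by _
      (+-mono-≤ (i≤j⇒0≤j-i (ψ-smooth z h k 0≤h 0≤k)) (i≤j⇒0≤j-i (ψ-convex z h l 0≤h 0≤l)))
      (trans (eq (ψ z) (ψ (z + h)) (ψ (z + k)) (ψ (z + h + k)) (ψ (z + l)) (ψ (z + h + l)) (h * k))
        (cong₂ _-_
          (cong (λ y → ψ y - ψ (z + l) + + 2 * (h * k)) (eq₁ z h l))
          (cong₂ (λ y w → ψ y - ψ w) (eq₂ x h k) (eq₃ x k))))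
      where
      z : ℤ
      z = x - k
      eq : ∀ z zh zk zhk zl zhl hk →
           zh + zk + + 2 * hk - (z + zhk) + (z + zhl - (zh + zl)) ≡ zhl - zl + + 2 * hk - (zhk - zk)
      eq = solve-∀
      eq₁ : ∀ z h l → z + h + l ≡ z + l + h
      eq₁ = solve-∀
      eq₂ : ∀ x h k → x - k + h + k ≡ x + h
      eq₂ = solve-∀
      eq₃ : ∀ x k → x - k + k ≡ x
      eq₃ = solve-∀

    private
      -- From the smaller to the larger set the slope of `φ` falls by `T + R`. The part `T` pays for
      -- the possible fall in the slope of `ψ`, which is subtracted, and `R` is slack.
      combine : ∀ {A B C D U V W Z T R} → U - V ≤ W - Z + T → 0ℤ ≤ R → B - A - (D - C) ≡ T + R →
                (D - W) - (C - Z) ≤ (B - U) - (A - V)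
      combine {A} {B} {C} {D} {U} {V} {W} {Z} {T} {R} le 0≤R r =
        ≤-by (W - Z + T - (U - V) + R) (+-mono-≤ (i≤j⇒0≤j-i le) 0≤R)
          (trans (eq₁ U V W Z T R) (trans (cong (λ T → W - Z + T - (U - V)) (sym r)) (eq₂ A B C D U V W Z)))
        where
        eq₁ : ∀ U V W Z T R → W - Z + T - (U - V) + R ≡ W - Z + (T + R) - (U - V)
        eq₁ = solve-∀
        eq₂ : ∀ A B C D U V W Z → W - Z + (B - A - (D - C)) - (U - V) ≡ (B - U) - (A - V) - ((D - W) - (C - Z))
        eq₂ = solve-∀

    -- A new element of `H` raises the deviation by `Q`. The `x` extra elements outside `H` shift it
    -- left by `P x`, which costs `2PQx`, exactly the fall that they cause in the slope of `φ`; the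
    -- `y` extra elements inside `H` shift it right and leave slack `2PQy`.
    G-submodular-b : ∀ a b x y → 0ℤ ≤ x → 0ℤ ≤ y →
      G (a + x) (1ℤ + (b + y)) - G (a + x) (b + y) ≤ G a (1ℤ + b) - G a b
    G-submodular-b a b x y 0≤x 0≤y =
      combine {A = φ p q (a + b)} {φ p q (a + (1ℤ + b))} {φ p q (a + x + (b + y))} {φ p q (a + x + (1ℤ + (b + y)))}
        (subst₂ (λ i j → i ≤ j + + 2 * (Q * (P * x)))
          (cong (λ w → ψ w - ψ (dev a b)) (eq₁ P Q a b))
          (cong₂ (λ w z → ψ w - ψ z) (eq₂ P Q a b x y) (eq₃ P Q a b x y))
          (ψ-slope (dev a b) Q (P * x) (Q * y) 0≤Q (*-nonneg 0≤P 0≤x) (*-nonneg 0≤Q 0≤y)))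
        (*-nonneg {+ 2} (+≤+ ℕ.z≤n) (*-nonneg 0≤P (*-nonneg 0≤Q 0≤y)))
        (eq₄ P Q a b x y)
      where
      eq₁ : ∀ P Q a b → Q * b - P * a + Q ≡ Q * (1ℤ + b) - P * a
      eq₁ = solve-∀
      eq₂ : ∀ P Q a b x y → Q * b - P * a - P * x + Q * y + Q ≡ Q * (1ℤ + (b + y)) - P * (a + x)
      eq₂ = solve-∀
      eq₃ : ∀ P Q a b x y → Q * b - P * a - P * x + Q * y ≡ Q * (b + y) - P * (a + x)
      eq₃ = solve-∀
      eq₄ : ∀ P Q a b x y →
        P * Q * ((a + (1ℤ + b)) * (P + Q - (a + (1ℤ + b)))) - P * Q * ((a + b) * (P + Q - (a + b)))
        - (P * Q * ((a + x + (1ℤ + (b + y))) * (P + Q - (a + x + (1ℤ + (b + y)))))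
           - P * Q * ((a + x + (b + y)) * (P + Q - (a + x + (b + y)))))
        ≡ + 2 * (Q * (P * x)) + + 2 * (P * (Q * y))
      eq₄ = solve-∀

    -- A new element outside `H` lowers the deviation by `P`, so the slope estimate is applied to
    -- `- dev`, with the roles of `x` and `y` exchanged.
    G-submodular-a : ∀ a b x y → 0ℤ ≤ x → 0ℤ ≤ y →
      G (1ℤ + (a + x)) (b + y) - G (a + x) (b + y) ≤ G (1ℤ + a) b - G a b
    G-submodular-a a b x y 0≤x 0≤y =
      combine {A = φ p q (a + b)} {φ p q (1ℤ + a + b)} {φ p q (a + x + (b + y))} {φ p q (1ℤ + (a + x) + (b + y))}
        (subst₂ (λ i j → i ≤ j + + 2 * (P * (Q * y)))
          (cong₂ _-_ (flip (eq₁ P Q a b)) (ψ-even (dev a b)))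
          (cong₂ _-_ (flip (eq₂ P Q a b x y)) (flip (eq₃ P Q a b x y)))
          (ψ-slope (- dev a b) P (Q * y) (P * x) 0≤P (*-nonneg 0≤Q 0≤y) (*-nonneg 0≤P 0≤x)))
        (*-nonneg {+ 2} (+≤+ ℕ.z≤n) (*-nonneg 0≤P (*-nonneg 0≤Q 0≤x)))
        (eq₄ P Q a b x y)
      where
      flip : ∀ {w z} → w ≡ - z → ψ w ≡ ψ z
      flip {z = z} eq = trans (cong ψ eq) (ψ-even z)
      eq₁ : ∀ P Q a b → - (Q * b - P * a) + P ≡ - (Q * b - P * (1ℤ + a))
      eq₁ = solve-∀
      eq₂ : ∀ P Q a b x y → - (Q * b - P * a) - Q * y + P * x + P ≡ - (Q * (b + y) - P * (1ℤ + (a + x)))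
      eq₂ = solve-∀
      eq₃ : ∀ P Q a b x y → - (Q * b - P * a) - Q * y + P * x ≡ - (Q * (b + y) - P * (a + x))
      eq₃ = solve-∀
      eq₄ : ∀ P Q a b x y →
        P * Q * ((1ℤ + a + b) * (P + Q - (1ℤ + a + b))) - P * Q * ((a + b) * (P + Q - (a + b)))
        - (P * Q * ((1ℤ + (a + x) + (b + y)) * (P + Q - (1ℤ + (a + x) + (b + y))))
           - P * Q * ((a + x + (b + y)) * (P + Q - (a + x + (b + y)))))
        ≡ + 2 * (P * (Q * y)) + + 2 * (P * (Q * x))
      eq₄ = solve-∀

    G≤φ : ∀ a b → G a b ≤ φ p q (a + b)
    G≤φ a b = ≤-by (ψ (dev a b)) (square-nonneg (dev a b - clamp (dev a b))) (eq (φ p q (a + b)) (ψ (dev a b)))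
      where
      eq : ∀ f p → p ≡ f - (f - p)
      eq = solve-∀

    G-inZone : ∀ a b → InZone (dev a b) → G a b ≡ φ p q (a + b)
    G-inZone a b z = trans (cong (λ w → φ p q (a + b) - w) (ψ-zero z)) (+-identityʳ _)

    -- The complement of `H` has deviation `−PQ`, at distance `PQ − g` from the zone, while `φ` has
    -- the value `(PQ)²`. The difference of squares is `2PQg − g²`.
    G-hidden : + g ≤ P * Q → G Q 0ℤ ≤ + 2 * (P * Q) * + g
    G-hidden g≤PQ = ≤-by (+ g * + g) (square-nonneg (+ g))
      (trans (eq P Q (+ g)) (cong (λ w → + 2 * (P * Q) * + g - (φ p q (Q + 0ℤ) - w)) (sym ψ-val)))
      where
      eq₀ : ∀ P Q → Q * 0ℤ - P * Q ≡ - (P * Q)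
      eq₀ = solve-∀
      ψ-val : ψ (dev Q 0ℤ) ≡ (P * Q - + g) * (P * Q - + g)
      ψ-val = trans (cong ψ (eq₀ P Q)) (trans (ψ-even (P * Q))
        (cong (λ c → (P * Q - c) * (P * Q - c)) (clamp-above g≤PQ)))
      eq : ∀ P Q g → g * g ≡ + 2 * (P * Q) * g
           - (P * Q * ((Q + 0ℤ) * (P + Q - (Q + 0ℤ))) - (P * Q - g) * (P * Q - g))
      eq = solve-∀

  module Hard {n : ℕ} (H : Subset n) (g : ℕ) where
    open DeadZone g public
    open Profile g (card H) (card (∁ H)) public

    F : Subset n → ℤ
    F S = G (+ card (S ∩ ∁ H)) (+ card (S ∩ H))

    F-nonneg : ∀ S → 0ℤ ≤ F S
    F-nonneg S = G-nonneg (+≤+ ℕ.z≤n) (+≤+ (∣p∩q∣≤∣q∣ S (∁ H))) (+≤+ ℕ.z≤n) (+≤+ (∣p∩q∣≤∣q∣ S H))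

    F-sym : ∀ S → F (∁ S) ≡ F S
    F-sym S = G-sym (cong +_ (card-∩-∁ S (∁ H))) (cong +_ (card-∩-∁ S H))

    F-submodular : ∀ A B v → A ⊆ B → v ∉ B → F (B ∪ ⁅ v ⁆) - F B ≤ F (A ∪ ⁅ v ⁆) - F A
    F-submodular A B v A⊆B v∉B = go (v ∈? H)
      where
      v∉A : v ∉ A
      v∉A v∈A = v∉B (A⊆B v∈A)
      a b a' b' x y : ℕ
      a  = card (A ∩ ∁ H)
      b  = card (A ∩ H)
      a' = card (B ∩ ∁ H)
      b' = card (B ∩ H)
      x  = a' ℕ.∸ a
      y  = b' ℕ.∸ b
      ea : a' ≡ a ℕ.+ x
      ea = sym (ℕ.m+[n∸m]≡n (card-∩-mono (∁ H) A⊆B))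
      eb : b' ≡ b ℕ.+ y
      eb = sym (ℕ.m+[n∸m]≡n (card-∩-mono H A⊆B))
      go : _ → F (B ∪ ⁅ v ⁆) - F B ≤ F (A ∪ ⁅ v ⁆) - F A
      go (yes v∈H) rewrite card-insert-∈ A H v∉A v∈H | card-insert-∈ B H v∉B v∈H
        | card-insert-∉ v A (∁ H) (x∈p⇒x∉∁p v∈H) | card-insert-∉ v B (∁ H) (x∈p⇒x∉∁p v∈H)
        | ea | eb = G-submodular-b (+ a) (+ b) (+ x) (+ y) (+≤+ ℕ.z≤n) (+≤+ ℕ.z≤n)
      go (no v∉H) rewrite card-insert-∉ v A H v∉H | card-insert-∉ v B H v∉H
        | card-insert-∈ A (∁ H) v∉A (x∉p⇒x∈∁p v∉H) | card-insert-∈ B (∁ H) v∉B (x∉p⇒x∈∁p v∉H)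
        | ea | eb = G-submodular-a (+ a) (+ b) (+ x) (+ y) (+≤+ ℕ.z≤n) (+≤+ ℕ.z≤n)

    F≤φ : ∀ S → F S ≤ φ (card H) (card (∁ H)) (+ card S)
    F≤φ S = subst (λ s → F S ≤ φ (card H) (card (∁ H)) (+ s)) (card-split S H) (G≤φ (+ card (S ∩ ∁ H)) (+ card (S ∩ H)))

    F-inZone : ∀ S → InZone (dev (+ card (S ∩ ∁ H)) (+ card (S ∩ H))) → F S ≡ φ (card H) (card (∁ H)) (+ card S)
    F-inZone S z = trans (G-inZone (+ card (S ∩ ∁ H)) (+ card (S ∩ H)) z)
      (cong (λ s → φ (card H) (card (∁ H)) (+ s)) (card-split S H))

    F-hidden : + g ≤ + card H * + card (∁ H) →
               F (∁ H) ≤ + 2 * (+ card H * + card (∁ H)) * + g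
    F-hidden g≤ = subst₂ (λ a b → G (+ a) (+ b) ≤ + 2 * (P * Q) * + g) (cong card (sym (∩-idem (∁ H))))
      (trans (sym (∣⊥∣≡0 n)) (cong card (sym (∩-inverseˡ H)))) (G-hidden g≤)

-- Derandomised concentration for one element per block

module BlockSampling where

  open HardFunctions using (card-∩-∁; card-∁)
  open import Data.Bool.Base using (not)
  open import Data.Fin.Base using (Fin; zero; suc)
  open import Data.Fin.Subset using (Subset; inside; outside; _∩_; ∁; ⁅_⁆; ⊥) renaming (∣_∣ to card)
  open import Data.Fin.Subset.Properties
  open import Data.Nat.Base
  open import Data.Nat.Properties
  open import Algebra.Properties.Semiring.Sum +-*-semiring
  open import Data.Nat.Tactic.RingSolver using (solve-∀)
  open import Data.Product.Base using (_×_; _,_; ∃; proj₁; proj₂)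
  open import Data.Sum.Base using (inj₁; inj₂)
  open import Data.Vec.Base using ([]; _∷_; _++_; take; drop)
  open import Data.Vec.Functional using (Vector)
  open import Data.Vec.Properties using (take++drop≡id; zipWith-++; map-++)
  open import Relation.Binary.PropositionalEquality

  -- Bernoulli's inequality `1 + j/K ≤ (1 + 1/K)^j`, cleared of denominators.
  pow-lower : ∀ K j → (K + j) * K ^ j ≤ K * suc K ^ j
  pow-lower K zero    = ≤-reflexive (cong (_* 1) (+-identityʳ K))
  pow-lower K (suc j) = begin
    (K + suc j) * (K * K ^ j)     ≤⟨ m≤m+n _ (j * K ^ j) ⟩
    (K + suc j) * (K * K ^ j) + j * K ^ j ≡⟨ eq K j (K ^ j) ⟩
    suc K * ((K + j) * K ^ j)     ≤⟨ *-monoʳ-≤ (suc K) (pow-lower K j) ⟩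
    suc K * (K * suc K ^ j)       ≡⟨ eq′ K (suc K ^ j) ⟩
    K * (suc K * suc K ^ j)       ∎
    where
    open ≤-Reasoning
    eq : ∀ K j x → (K + suc j) * (K * x) + j * x ≡ suc K * ((K + j) * x)
    eq = solve-∀
    eq′ : ∀ K x → suc K * (K * x) ≡ K * (suc K * x)
    eq′ = solve-∀

  -- A matching estimate `(1 + 1/K)^j ≤ 1 + j/K + (j/K)²`, valid as long as `j ≤ K`.
  pow-upper : ∀ K j → j ≤ K → K * K * suc K ^ j ≤ (K * K + j * K + j * j) * K ^ j
  pow-upper K zero    _   = ≤-reflexive (eq K)
    where
    eq : ∀ K → K * K * 1 ≡ (K * K + 0 * K + 0 * 0) * 1
    eq = solve-∀
  pow-upper K (suc j) j<K = begin
    K * K * (suc K * suc K ^ j)                        ≡⟨ eq₁ K (suc K ^ j) ⟩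
    suc K * (K * K * suc K ^ j)                        ≤⟨ *-monoʳ-≤ (suc K) (pow-upper K j j≤K) ⟩
    suc K * ((K * K + j * K + j * j) * K ^ j)          ≡⟨ eq₂ K j (K ^ j) ⟩
    -- The target exceeds `r` by `j * K + K`, and `j ≤ K` bounds the leftover `j * j` by `j * K`.
    r * K ^ j + j * j * K ^ j                          ≤⟨ +-monoʳ-≤ (r * K ^ j) (*-monoˡ-≤ (K ^ j) (≤-trans (*-monoʳ-≤ j j≤K) (m≤m+n _ K))) ⟩
    r * K ^ j + (j * K + K) * K ^ j                    ≡⟨ eq₃ K j (K ^ j) ⟩
    (K * K + suc j * K + suc j * suc j) * (K * K ^ j)  ∎
    where
    open ≤-Reasoning
    j≤K : j ≤ K
    j≤K = ≤-trans (n≤1+n j) j<K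
    r : ℕ
    r = K * K * K + j * K * K + j * j * K + K * K + j * K
    eq₁ : ∀ K x → K * K * (suc K * x) ≡ suc K * (K * K * x)
    eq₁ = solve-∀
    eq₂ : ∀ K j x → suc K * ((K * K + j * K + j * j) * x) ≡
          (K * K * K + j * K * K + j * j * K + K * K + j * K) * x + j * j * x
    eq₂ = solve-∀
    eq₃ : ∀ K j x → (K * K * K + j * K * K + j * j * K + K * K + j * K) * x + (j * K + K) * x ≡
          (K * K + suc j * K + suc j * suc j) * (K * x)
    eq₃ = solve-∀

  ^-distribʳ-* : ∀ n x y → (x * y) ^ n ≡ x ^ n * y ^ n
  ^-distribʳ-* zero    x y = refl
  ^-distribʳ-* (suc n) x y =
    trans (cong (x * y *_) (^-distribʳ-* n x y)) ([m*n]*[o*p]≡[m*o]*[n*p] x y (x ^ n) (y ^ n))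

  average : ∀ {m} .{{_ : NonZero m}} (x : Vector ℕ m) → ∃ λ j → m * x j ≤ sum x
  average {suc zero}    x = zero , ≤-refl
  average {suc (suc m)} x = go (average (λ i → x (suc i)))
    where
    go : (∃ λ j → suc m * x (suc j) ≤ sum (λ i → x (suc i))) → ∃ λ j → suc (suc m) * x j ≤ sum x
    go (j , le) with ≤-total (x zero) (x (suc j))
    ... | inj₁ x₀≤ = zero , +-monoʳ-≤ (x zero) (≤-trans (*-monoʳ-≤ (suc m) x₀≤) le)
    ... | inj₂ ≤x₀ = suc j , +-mono-≤ ≤x₀ le

  sum-mono : ∀ {m} {x y : Vector ℕ m} → (∀ i → x i ≤ y i) → sum x ≤ sum y
  sum-mono {zero}  le = z≤n
  sum-mono {suc m} le = +-mono-≤ (le zero) (sum-mono (λ i → le (suc i)))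

  term≤sum : ∀ {m} (x : Vector ℕ m) i → x i ≤ sum x
  term≤sum x zero    = m≤m+n (x zero) _
  term≤sum x (suc i) = ≤-trans (term≤sum (λ j → x (suc j)) i) (m≤n+m _ (x zero))

  sum-one : ∀ m → sum {m} (λ _ → 1) ≡ m
  sum-one zero    = refl
  sum-one (suc m) = cong suc (sum-one m)

  card-++ : ∀ {m n} (S : Subset m) (T : Subset n) → card (S ++ T) ≡ card S + card T
  card-++ []            T = refl
  card-++ (inside  ∷ S) T = cong suc (card-++ S T)
  card-++ (outside ∷ S) T = card-++ S T

  card-∩-++ : ∀ {m n} (S H : Subset m) (T J : Subset n) →
              card ((S ++ T) ∩ (H ++ J)) ≡ card (S ∩ H) + card (T ∩ J)
  card-∩-++ S H T J = trans (cong card (zipWith-++ _ S T H J)) (card-++ (S ∩ H) (T ∩ J))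

  module Weight (A B X Y : ℕ) where

    -- With `X = A^L`, `Y = B^L` and `|H| = p` in a ground set of `p L` elements, this is
    -- `(AB)^(pL) (A/B)^(L|S ∩ H| − |S|)`: an exponential moment of the deviation, scaled to be a
    -- natural number.
    weight : ∀ {m} → Subset m → Subset m → ℕ
    weight S H = X ^ card (S ∩ H) * Y ^ card (∁ S ∩ H) * (A ^ card (∁ S) * B ^ card S)

    -- Multiplicativity is what allows the blocks to be decided one at a time.
    weight-++ : ∀ {m n} (S H : Subset m) (T J : Subset n) →
                weight (S ++ T) (H ++ J) ≡ weight S H * weight T J
    weight-++ S H T J rewrite map-++ Data.Bool.Base.not S T
      | card-∩-++ S H T J | card-∩-++ (∁ S) H (∁ T) J
      | card-++ S T | card-++ (∁ S) (∁ T)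
      | ^-distribˡ-+-* X (card (S ∩ H)) (card (T ∩ J))
      | ^-distribˡ-+-* Y (card (∁ S ∩ H)) (card (∁ T ∩ J))
      | ^-distribˡ-+-* A (card (∁ S)) (card (∁ T))
      | ^-distribˡ-+-* B (card S) (card T) =
      eq (X ^ card (S ∩ H)) (X ^ card (T ∩ J)) (Y ^ card (∁ S ∩ H)) (Y ^ card (∁ T ∩ J))
         (A ^ card (∁ S)) (A ^ card (∁ T)) (B ^ card S) (B ^ card T)
      where
      eq : ∀ x x' y y' a a' b b' → x * x' * (y * y') * (a * a' * (b * b')) ≡
           x * y * (a * b) * (x' * y' * (a' * b'))
      eq = solve-∀

    private
      point : ∀ {m} → Subset m → Fin m → ℕ
      point S j = X ^ card (S ∩ ⁅ j ⁆) * Y ^ card (∁ S ∩ ⁅ j ⁆)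

      card-∩-⊥ : ∀ {m} (S : Subset m) → card (S ∩ ⊥) ≡ 0
      card-∩-⊥ {m} S = trans (cong card (∩-zeroʳ S)) (∣⊥∣≡0 m)

      sum-point : ∀ {m} (S : Subset m) → sum (point S) ≡ card S * X + card (∁ S) * Y
      sum-point []            = refl
      sum-point (inside  ∷ S) rewrite card-∩-⊥ S | card-∩-⊥ (∁ S) | sum-point S =
        eq X Y (card S) (card (∁ S))
        where
        eq : ∀ X Y s t → X * 1 * 1 + (s * X + t * Y) ≡ suc s * X + t * Y
        eq = solve-∀
      sum-point (outside ∷ S) rewrite card-∩-⊥ S | card-∩-⊥ (∁ S) | sum-point S =
        eq X Y (card S) (card (∁ S))
        where
        eq : ∀ X Y s t → 1 * (Y * 1) + (s * X + t * Y) ≡ s * X + suc t * Y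
        eq = solve-∀

    sum-weight : ∀ {m} (S : Subset m) → sum (λ j → weight S ⁅ j ⁆) ≡
                 (card S * X + card (∁ S) * Y) * (A ^ card (∁ S) * B ^ card S)
    sum-weight S = trans (sym (*-distribʳ-sum (A ^ card (∁ S) * B ^ card S) (point S)))
      (cong (_* (A ^ card (∁ S) * B ^ card S)) (sum-point S))

  -- A / B = (1 + 1/K) ^ E. Its L-th power is at most 1 + (E L + 1) / K because
  -- K = (E L)², so each block multiplies the mean weight by at most M / K. Over c u
  -- blocks this loses (1 + 1/K) ^ (c u), and E = c + 2 leaves (1 + 1/K) ^ (2 u).
  module Concentration (c E L K : ℕ) .{{_ : NonZero E}} .{{_ : NonZero L}} .{{_ : NonZero K}}
    (E≡ : E ≡ suc (suc c)) (K≡ : K ≡ E * L * (E * L)) where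

    A B M : ℕ
    A = suc K ^ E
    B = K ^ E
    M = suc K * (A ^ L * B ^ L)

    open Weight A B (A ^ L) (B ^ L)

    private
      instance
        EL≢0 : NonZero (E * L)
        EL≢0 = m*n≢0 E L
        B≢0 : NonZero B
        B≢0 = m^n≢0 K E
        A≢0 : NonZero A
        A≢0 = m^n≢0 (suc K) E

    A^L-upper : K * A ^ L ≤ (K + E * L + 1) * B ^ L
    A^L-upper = *-cancelˡ-≤ K (begin
      K * (K * A ^ L)                          ≡⟨ *-assoc K K _ ⟨
      K * K * A ^ L                            ≡⟨ cong (K * K *_) (^-*-assoc (suc K) E L) ⟩
      K * K * suc K ^ (E * L)                  ≤⟨ pow-upper K (E * L) (subst (E * L ≤_) (sym K≡) (m≤m*n (E * L) (E * L))) ⟩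
      (K * K + E * L * K + E * L * (E * L)) * K ^ (E * L) ≡⟨ cong (λ k → (K * K + E * L * K + k) * K ^ (E * L)) K≡ ⟨
      (K * K + E * L * K + K) * K ^ (E * L)    ≡⟨ cong ((K * K + E * L * K + K) *_) (^-*-assoc K E L) ⟨
      (K * K + E * L * K + K) * B ^ L          ≡⟨ eq K (E * L) (B ^ L) ⟩
      K * ((K + E * L + 1) * B ^ L)            ∎)
      where
      open ≤-Reasoning
      eq : ∀ K J x → (K * K + J * K + K) * x ≡ K * ((K + J + 1) * x)
      eq = solve-∀

    A^s-lower : ∀ s → (K + E * s) * B ^ s ≤ K * A ^ s
    A^s-lower s = subst₂ (λ x y → (K + E * s) * x ≤ K * y)
      (sym (^-*-assoc K E s)) (sym (^-*-assoc (suc K) E s)) (pow-lower K (E * s))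

    -- After division by `B^L`, the mean of `(A/B)^L` with probability `s/L` and `1` otherwise is at
    -- most `1 + Es/K + 1/K`. This is below `(1 + 1/K)(1 + Es/K)`, and Bernoulli bounds the second
    -- factor by `(A/B)^s`.
    two-point : ∀ s t → s + t ≡ L → K * (s * A ^ L + t * B ^ L) ≤ L * suc K * (A ^ s * B ^ t)
    two-point s t s+t = *-cancelˡ-≤ K (begin
      K * (K * (s * A ^ L + t * B ^ L))
        ≡⟨ eq₁ K s t (A ^ L) (B ^ L) ⟩
      K * (s * (K * A ^ L) + t * K * B ^ L)
        ≤⟨ *-monoʳ-≤ K (+-monoˡ-≤ (t * K * B ^ L) (*-monoʳ-≤ s A^L-upper)) ⟩
      K * (s * ((K + E * L + 1) * B ^ L) + t * K * B ^ L)
        ≡⟨ eq₂ K s t (E * L) (B ^ L) ⟩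
      K * ((s + t) * K + s * (E * L) + s) * B ^ L
        ≤⟨ *-monoˡ-≤ (B ^ L) (*-monoʳ-≤ K (+-monoʳ-≤ ((s + t) * K + s * (E * L)) (subst (s ≤_) s+t (m≤m+n s t)))) ⟩
      K * ((s + t) * K + s * (E * L) + L) * B ^ L
        ≡⟨ cong (λ r → K * (r * K + s * (E * L) + L) * B ^ L) s+t ⟩
      K * (L * K + s * (E * L) + L) * B ^ L
        -- Adding `L * E * s` completes the product `(K + 1)(K + E s)`.
        ≤⟨ *-monoˡ-≤ (B ^ L) (m≤m+n (K * (L * K + s * (E * L) + L)) (L * E * s)) ⟩
      (K * (L * K + s * (E * L) + L) + L * E * s) * B ^ L
        ≡⟨ cong₂ _*_ (eq₃ K L E s) (trans (cong (B ^_) (sym s+t)) (^-distribˡ-+-* B s t)) ⟩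
      L * suc K * (K + E * s) * (B ^ s * B ^ t)
        ≡⟨ eq₄ (L * suc K) (K + E * s) (B ^ s) (B ^ t) ⟩
      L * suc K * ((K + E * s) * B ^ s * B ^ t)
        ≤⟨ *-monoʳ-≤ (L * suc K) (*-monoˡ-≤ (B ^ t) (A^s-lower s)) ⟩
      L * suc K * (K * A ^ s * B ^ t)
        ≡⟨ eq₅ (L * suc K) K (A ^ s) (B ^ t) ⟩
      K * (L * suc K * (A ^ s * B ^ t))
        ∎)
      where
      open ≤-Reasoning
      eq₁ : ∀ K s t x y → K * (K * (s * x + t * y)) ≡ K * (s * (K * x) + t * K * y)
      eq₁ = solve-∀
      eq₂ : ∀ K s t J y → K * (s * ((K + J + 1) * y) + t * K * y) ≡ K * ((s + t) * K + s * J + s) * y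
      eq₂ = solve-∀
      eq₃ : ∀ K L E s → K * (L * K + s * (E * L) + L) + L * E * s ≡ L * suc K * (K + E * s)
      eq₃ = solve-∀
      eq₄ : ∀ m k x y → m * k * (x * y) ≡ m * (k * x * y)
      eq₄ = solve-∀
      eq₅ : ∀ m k x y → m * (k * x * y) ≡ k * (m * (x * y))
      eq₅ = solve-∀

    -- The normalising factor `A^t B^s` turns the bound `A^s B^t` into `A^L B^L`, so that the same
    -- `M` serves for every `S`.
    sum-weight-≤ : ∀ (S : Subset L) → K * sum (λ j → weight S ⁅ j ⁆) ≤ L * M
    sum-weight-≤ S = begin
      K * sum (λ j → weight S ⁅ j ⁆)
        ≡⟨ cong (K *_) (sum-weight S) ⟩
      K * ((s * A ^ L + t * B ^ L) * (A ^ t * B ^ s))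
        ≡⟨ *-assoc K (s * A ^ L + t * B ^ L) (A ^ t * B ^ s) ⟨
      K * (s * A ^ L + t * B ^ L) * (A ^ t * B ^ s)
        ≤⟨ *-monoˡ-≤ (A ^ t * B ^ s) (two-point s t s+t) ⟩
      L * suc K * (A ^ s * B ^ t) * (A ^ t * B ^ s)
        ≡⟨ eq (L) (suc K) (A ^ s) (A ^ t) (B ^ s) (B ^ t) ⟩
      L * (suc K * (A ^ s * A ^ t * (B ^ s * B ^ t)))
        ≡⟨ cong₂ (λ x y → L * (suc K * (x * y))) (collect A) (collect B) ⟩
      L * M
        ∎
      where
      open ≤-Reasoning
      s t : ℕ
      s = card S
      t = card (∁ S)
      s+t : s + t ≡ L
      s+t = trans (+-comm s t) (card-∁ S)
      collect : ∀ x → x ^ s * x ^ t ≡ x ^ L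
      collect x = trans (sym (^-distribˡ-+-* x s t)) (cong (x ^_) s+t)
      eq : ∀ l k x y z w → l * k * (x * w) * (y * z) ≡ l * (k * (x * y * (z * w)))
      eq = solve-∀

    -- Conditional expectations: in each block of L elements pick one whose
    -- contribution to the total weight is at most average.
    select : ∀ p {Q} (S : Fin Q → Subset (p * L)) (w : Fin Q → ℕ) →
             ∃ λ H → card H ≡ p × K ^ p * sum (λ q → w q * weight (S q) H) ≤ sum w * M ^ p
    select zero S w = [] , refl , ≤-reflexive
      (trans (+-identityʳ _) (trans (sum-cong-≗ (λ q → cong (w q *_) (weight-[] (S q))))
        (trans (sum-cong-≗ (λ q → *-identityʳ (w q))) (sym (*-identityʳ (sum w))))))
      where
      weight-[] : ∀ (T : Subset 0) → weight T [] ≡ 1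
      weight-[] [] = refl
    select (suc p) {Q} S w = ⁅ j ⁆ ++ H ,
      trans (card-++ ⁅ j ⁆ H) (cong₂ _+_ (∣⁅x⁆∣≡1 j) cardH) , (begin
      K * K ^ p * sum (λ q → w q * weight (S q) (⁅ j ⁆ ++ H))
        ≡⟨ cong (K * K ^ p *_) (sum-cong-≗ split) ⟩
      K * K ^ p * sum (λ q → w′ q * weight (tail q) H)
        ≡⟨ *-assoc K (K ^ p) _ ⟩
      K * (K ^ p * sum (λ q → w′ q * weight (tail q) H))
        ≤⟨ *-monoʳ-≤ K boundH ⟩
      K * (sum w′ * M ^ p)
        ≡⟨ *-assoc K (sum w′) (M ^ p) ⟨
      K * sum w′ * M ^ p
        ≤⟨ *-monoˡ-≤ (M ^ p) step ⟩
      sum w * M * M ^ p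
        ≡⟨ *-assoc (sum w) M (M ^ p) ⟩
      sum w * (M * M ^ p) ∎)
      where
      open ≤-Reasoning
      head : Fin Q → Subset L
      head q = take L (S q)
      tail : Fin Q → Subset (p * L)
      tail q = drop L (S q)
      x : Fin L → ℕ
      x j = sum (λ q → w q * weight (head q) ⁅ j ⁆)
      j : Fin L
      j = proj₁ (average x)
      -- The coefficients collect the contributions of the blocks already decided, which is why the
      -- induction is over arbitrary `w`.
      w′ : Fin Q → ℕ
      w′ q = w q * weight (head q) ⁅ j ⁆
      rest = select p tail w′
      H : Subset (p * L)
      H = proj₁ rest
      cardH : card H ≡ p
      cardH = proj₁ (proj₂ rest)
      boundH : K ^ p * sum (λ q → w′ q * weight (tail q) H) ≤ sum w′ * M ^ p
      boundH = proj₂ (proj₂ rest)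
      split : ∀ q → w q * weight (S q) (⁅ j ⁆ ++ H) ≡ w′ q * weight (tail q) H
      split q = trans
        (cong (w q *_) (trans (cong (λ T → weight T (⁅ j ⁆ ++ H)) (sym (take++drop≡id L (S q))))
                              (weight-++ (head q) ⁅ j ⁆ (tail q) H)))
        (sym (*-assoc (w q) _ _))
      swap : ∀ a b c → a * (b * c) ≡ b * (a * c)
      swap = solve-∀
      step : K * sum w′ ≤ sum w * M
      step = *-cancelˡ-≤ L (begin
        L * (K * x j)
          ≡⟨ swap L K (x j) ⟩
        K * (L * x j)
          ≤⟨ *-monoʳ-≤ K (proj₂ (average x)) ⟩
        K * sum x
          ≡⟨ cong (K *_) (∑-comm (λ j q → w q * weight (head q) ⁅ j ⁆)) ⟩
        K * sum (λ q → sum (λ j → w q * weight (head q) ⁅ j ⁆))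
          ≡⟨ cong (K *_) (sum-cong-≗ (λ q → sym (*-distribˡ-sum (w q) (λ j → weight (head q) ⁅ j ⁆)))) ⟩
        K * sum (λ q → w q * sum (λ j → weight (head q) ⁅ j ⁆))
          ≡⟨ *-distribˡ-sum K (λ q → w q * sum (λ j → weight (head q) ⁅ j ⁆)) ⟩
        sum (λ q → K * (w q * sum (λ j → weight (head q) ⁅ j ⁆)))
          ≡⟨ sum-cong-≗ (λ q → swap K (w q) _) ⟩
        sum (λ q → w q * (K * sum (λ j → weight (head q) ⁅ j ⁆)))
          ≤⟨ sum-mono (λ q → *-monoʳ-≤ (w q) (sum-weight-≤ (head q))) ⟩
        sum (λ q → w q * (L * M))
          ≡⟨ *-distribʳ-sum (L * M) w ⟨
        sum w * (L * M)
          ≡⟨ swap (sum w) L M ⟩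
        L * (sum w * M) ∎)

    -- Markov's inequality: a set whose excess is at least `u` has by itself a weight of at least
    -- `(A/B)^u` in the normalised scale, where the bound is `Q (1 + 1/K)^(cu)`. Since `E = c + 2`,
    -- comparing the two leaves `(1 + 1/K)^(2u) ≤ Q`.
    weight-large : ∀ u {Q} (S H : Subset (c * u * L)) → card H ≡ c * u →
      K ^ (c * u) * weight S H ≤ Q * M ^ (c * u) →
      card S + u ≤ L * card (S ∩ H) → suc K ^ (2 * u) ≤ Q * K ^ (2 * u)
    weight-large u {Q} S H cardH le large = final
      where
      open ≤-Reasoning
      p b b′ s t z y : ℕ
      p  = c * u
      b  = card (S ∩ H)
      b′ = card (∁ S ∩ H)
      s  = card S
      t  = card (∁ S)
      -- `z` is the excess beyond `u`, and `y` the exponent of `B` in the weight. As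
      -- `y + (u + z) = p L`, the weight is `common * A^(u + z)`, and `M^p` is `common * B^(u + z)`
      -- up to a power of `K + 1`.
      z  = L * b ∸ (s + u)
      y  = L * b′ + s
      b+b′ : b′ + b ≡ p
      b+b′ = trans (card-∩-∁ S H) cardH
      s+t : t + s ≡ p * L
      s+t = card-∁ S
      Lb : L * b ≡ s + u + z
      Lb = sym (m+[n∸m]≡n large)
      y+ : y + (u + z) ≡ p * L
      y+ = trans (assoc (L * b′) s u z) (trans (cong (L * b′ +_) (sym Lb))
        (trans (sym (*-distribˡ-+ L b′ b)) (trans (cong (L *_) b+b′) (*-comm L p))))
        where
        assoc : ∀ a b c d → a + b + (c + d) ≡ a + (b + c + d)
        assoc = solve-∀
      Lb+t : L * b + t ≡ y + (u + z) + (u + z)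
      Lb+t = trans (cong (_+ t) Lb) (trans (rearrange s u z t) (cong (_+ (u + z)) (trans s+t (sym y+))))
        where
        rearrange : ∀ s u z t → s + u + z + t ≡ t + s + (u + z)
        rearrange = solve-∀
      v : ℕ
      v = u + z
      common : ℕ
      common = A ^ (y + v) * B ^ y
      instance
        common≢0 : NonZero common
        common≢0 = m*n≢0 (A ^ (y + v)) (B ^ y) {{m^n≢0 A (y + v)}} {{m^n≢0 B y}}
        A^z≢0 : NonZero (A ^ z)
        A^z≢0 = m^n≢0 A z
      weight≡ : weight S H ≡ common * A ^ v
      weight≡ = begin-equality
        (A ^ L) ^ b * (B ^ L) ^ b′ * (A ^ t * B ^ s)
          ≡⟨ cong₂ (λ x x′ → x * x′ * (A ^ t * B ^ s)) (^-*-assoc A L b) (^-*-assoc B L b′) ⟩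
        A ^ (L * b) * B ^ (L * b′) * (A ^ t * B ^ s)
          ≡⟨ mix (A ^ (L * b)) (B ^ (L * b′)) (A ^ t) (B ^ s) ⟩
        (A ^ (L * b) * A ^ t) * (B ^ (L * b′) * B ^ s)
          ≡⟨ cong₂ _*_ (^-distribˡ-+-* A (L * b) t) (^-distribˡ-+-* B (L * b′) s) ⟨
        A ^ (L * b + t) * B ^ y
          ≡⟨ cong (λ e → A ^ e * B ^ y) Lb+t ⟩
        A ^ (y + v + v) * B ^ y
          ≡⟨ cong (_* B ^ y) (^-distribˡ-+-* A (y + v) v) ⟩
        A ^ (y + v) * A ^ v * B ^ y
          ≡⟨ mix′ (A ^ (y + v)) (A ^ v) (B ^ y) ⟩
        common * A ^ v ∎
        where
        mix : ∀ a b c d → a * b * (c * d) ≡ a * c * (b * d)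
        mix = solve-∀
        mix′ : ∀ a b c → a * b * c ≡ a * c * b
        mix′ = solve-∀
      M^p≡ : M ^ p ≡ suc K ^ p * (common * B ^ v)
      M^p≡ = begin-equality
        (suc K * (A ^ L * B ^ L)) ^ p
          ≡⟨ ^-distribʳ-* p (suc K) (A ^ L * B ^ L) ⟩
        suc K ^ p * (A ^ L * B ^ L) ^ p
          ≡⟨ cong (suc K ^ p *_) (^-distribʳ-* p (A ^ L) (B ^ L)) ⟩
        suc K ^ p * ((A ^ L) ^ p * (B ^ L) ^ p)
          ≡⟨ cong (suc K ^ p *_) (cong₂ _*_ (expo A) (expo B)) ⟩
        suc K ^ p * (A ^ (y + v) * B ^ (y + v))
          ≡⟨ cong (λ x → suc K ^ p * (A ^ (y + v) * x)) (^-distribˡ-+-* B y v) ⟩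
        suc K ^ p * (A ^ (y + v) * (B ^ y * B ^ v))
          ≡⟨ cong (suc K ^ p *_) (*-assoc (A ^ (y + v)) (B ^ y) (B ^ v)) ⟨
        suc K ^ p * (common * B ^ v) ∎
        where
        expo : ∀ x → (x ^ L) ^ p ≡ x ^ (y + v)
        expo x = trans (^-*-assoc x L p) (cong (x ^_) (trans (*-comm L p) (sym y+)))
      step₁ : K ^ p * A ^ v ≤ Q * (suc K ^ p * B ^ v)
      step₁ = *-cancelˡ-≤ common (begin
        common * (K ^ p * A ^ v)              ≡⟨ swap common (K ^ p) (A ^ v) ⟩
        K ^ p * (common * A ^ v)              ≡⟨ cong (K ^ p *_) weight≡ ⟨
        K ^ p * weight S H                    ≤⟨ le ⟩
        Q * M ^ p                             ≡⟨ cong (Q *_) M^p≡ ⟩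
        Q * (suc K ^ p * (common * B ^ v))    ≡⟨ swap′ Q (suc K ^ p) common (B ^ v) ⟩
        common * (Q * (suc K ^ p * B ^ v))    ∎)
        where
        swap : ∀ a b c → a * (b * c) ≡ b * (a * c)
        swap = solve-∀
        swap′ : ∀ a b c d → a * (b * (c * d)) ≡ c * (a * (b * d))
        swap′ = solve-∀
      -- The excess beyond `u` is discarded, using `B ≤ A`.
      step₂ : K ^ p * A ^ u ≤ Q * (suc K ^ p * B ^ u)
      step₂ = *-cancelʳ-≤ (K ^ p * A ^ u) (Q * (suc K ^ p * B ^ u)) (A ^ z) (begin
        K ^ p * A ^ u * A ^ z                 ≡⟨ *-assoc (K ^ p) (A ^ u) (A ^ z) ⟩
        K ^ p * (A ^ u * A ^ z)               ≡⟨ cong (K ^ p *_) (^-distribˡ-+-* A u z) ⟨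
        K ^ p * A ^ v                         ≤⟨ step₁ ⟩
        Q * (suc K ^ p * B ^ v)               ≡⟨ cong (λ x → Q * (suc K ^ p * x)) (^-distribˡ-+-* B u z) ⟩
        Q * (suc K ^ p * (B ^ u * B ^ z))     ≤⟨ *-monoʳ-≤ Q (*-monoʳ-≤ (suc K ^ p) (*-monoʳ-≤ (B ^ u) (^-monoˡ-≤ z (^-monoˡ-≤ E (n≤1+n K))))) ⟩
        Q * (suc K ^ p * (B ^ u * A ^ z))     ≡⟨ assoc Q (suc K ^ p) (B ^ u) (A ^ z) ⟩
        Q * (suc K ^ p * B ^ u) * A ^ z       ∎)
        where
        assoc : ∀ a b c d → a * (b * (c * d)) ≡ a * (b * c) * d
        assoc = solve-∀
      instance
        K^p≢0 : NonZero (K ^ p * suc K ^ p)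
        K^p≢0 = m*n≢0 (K ^ p) (suc K ^ p) {{m^n≢0 K p}} {{m^n≢0 (suc K) p}}
      expand : ∀ x → (x ^ E) ^ u ≡ x ^ (2 * u) * x ^ p
      expand x = trans (^-*-assoc x E u) (trans (cong (x ^_) (trans (cong (_* u) E≡) (eq c u))) (^-distribˡ-+-* x (2 * u) p))
        where
        eq : ∀ c u → suc (suc c) * u ≡ 2 * u + c * u
        eq = solve-∀
      final : suc K ^ (2 * u) ≤ Q * K ^ (2 * u)
      final = *-cancelˡ-≤ (K ^ p * suc K ^ p) (begin
        K ^ p * suc K ^ p * suc K ^ (2 * u)           ≡⟨ eq₁ (K ^ p) (suc K ^ p) (suc K ^ (2 * u)) ⟩
        K ^ p * (suc K ^ (2 * u) * suc K ^ p)         ≡⟨ cong (K ^ p *_) (expand (suc K)) ⟨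
        K ^ p * A ^ u                                 ≤⟨ step₂ ⟩
        Q * (suc K ^ p * B ^ u)                       ≡⟨ cong (λ x → Q * (suc K ^ p * x)) (expand K) ⟩
        Q * (suc K ^ p * (K ^ (2 * u) * K ^ p))       ≡⟨ eq₂ Q (suc K ^ p) (K ^ (2 * u)) (K ^ p) ⟩
        K ^ p * suc K ^ p * (Q * K ^ (2 * u))         ∎)
        where
        eq₁ : ∀ a b c → a * b * c ≡ a * (c * b)
        eq₁ = solve-∀
        eq₂ : ∀ a b c d → a * (b * (c * d)) ≡ d * b * (a * c)
        eq₂ = solve-∀

    -- With unit coefficients the total weight starts at `Q`, and it bounds the weight of each set;
    -- one violating set would thus contradict the smallness of `Q`.
    concentrated : ∀ u {Q} (S : Fin Q → Subset (c * u * L)) → Q * K ^ (2 * u) < suc K ^ (2 * u) →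
      ∃ λ H → card H ≡ c * u × (∀ q → L * card (S q ∩ H) ≤ card (S q) + u)
    concentrated u {Q} S few = H , cardH , λ q → ≮⇒≥ λ over →
      <⇒≱ few (weight-large u {Q} (S q) H cardH (small q) (<⇒≤ over))
      where
      open ≤-Reasoning
      selection = select (c * u) S (λ _ → 1)
      H : Subset (c * u * L)
      H = proj₁ selection
      cardH : card H ≡ c * u
      cardH = proj₁ (proj₂ selection)
      small : ∀ q → K ^ (c * u) * weight (S q) H ≤ Q * M ^ (c * u)
      small q = begin
        K ^ (c * u) * weight (S q) H
          ≤⟨ *-monoʳ-≤ (K ^ (c * u)) (term≤sum (λ q → weight (S q) H) q) ⟩
        K ^ (c * u) * sum (λ q → weight (S q) H)
          ≡⟨ cong (K ^ (c * u) *_) (sum-cong-≗ (λ q → *-identityˡ (weight (S q) H))) ⟨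
        K ^ (c * u) * sum (λ q → 1 * weight (S q) H)
          ≤⟨ proj₂ (proj₂ selection) ⟩
        sum (λ (_ : Fin Q) → 1) * M ^ (c * u)
          ≡⟨ cong (_* M ^ (c * u)) (sum-one Q) ⟩
        Q * M ^ (c * u) ∎

-- Sizes of parts, the planted partition, runs of decision trees, hidden sets

module Partitions where

  open HardFunctions using (card-∩-∁; card-∁)
  open BlockSampling
  open import Data.Fin.Base using (Fin; zero; suc)
  import Data.Fin.Properties as Fin
  open import Data.Fin.Subset as Subset using (Subset; Side; inside; outside; _∈_; _∉_; _∩_; ∁; ⁅_⁆; ⊥) renaming (∣_∣ to card)
  open import Data.Fin.Subset.Properties
  open import Data.List.Base as List using (List; []; _∷_; length)
  import Data.List.Membership.Propositional as List
  import Data.List.Membership.Propositional.Properties as List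
  import Data.List.Properties as List
  open import Data.List.Relation.Unary.Any as Any using (index)
  open import Data.List.Relation.Unary.Any.Properties using (lookup-index)
  open import Data.Nat.Base
  open import Data.Nat.Properties
  open import Data.Nat.Tactic.RingSolver using (solve-∀)
  open import Algebra.Properties.Semiring.Sum +-*-semiring
  open import Data.Product.Base using (_×_; _,_; ∃-syntax; proj₁; proj₂)
  open import Data.Vec.Base as Vec using ([]; _∷_; _++_; take; drop; here; there)
  open import Data.Vec.Functional using (Vector)
  open import Data.Vec.Properties using (take++drop≡id; map-++)
  open import Function.Base using (_∘_)
  open import Relation.Binary.PropositionalEquality
  open import Relation.Nullary using (contradiction; yes; no)

  sum-indicator : ∀ {k} (x : Vector ℕ k) i → x i ≡ 1 → (∀ j → j ≢ i → x j ≡ 0) → sum x ≡ 1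
  sum-indicator {suc k} x zero xᵢ≡1 else0 = cong₂ _+_ xᵢ≡1
    (trans (sum-cong-≗ (λ j → else0 (suc j) λ ())) (sum-replicate-zero k))
  sum-indicator {suc k} x (suc i) xᵢ≡1 else0 = cong₂ _+_ (else0 zero λ ())
    (sum-indicator (x ∘ suc) i xᵢ≡1 (λ j j≢i → else0 (suc j) (j≢i ∘ Fin.suc-injective)))

  -- Induction on the ground set: element `zero` lies in exactly one part, so the heads contribute
  -- `1`.
  sum-card : ∀ {n k} (S : Vector (Subset n) k) →
             (∀ {i j v} → v ∈ S i → v ∈ S j → i ≡ j) → (∀ v → ∃[ i ] v ∈ S i) →
             sum (λ i → card (S i)) ≡ n
  sum-card {zero}  {k} S disjoint covers =
    trans (sum-cong-≗ (λ i → n≤0⇒n≡0 (∣p∣≤n (S i)))) (sum-replicate-zero k)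
  sum-card {suc n} {k} S disjoint covers = trans (sum-cong-≗ (λ i → card-uncons (S i)))
    (trans (∑-distrib-+ (λ i → bit (Vec.head (S i))) (λ i → card (Vec.tail (S i))))
    (cong₂ _+_
      (sum-indicator _ (proj₁ (covers zero)) (bit-∈ (proj₂ (covers zero)))
        (λ j j≢i → bit-∉ λ z∈Sj → j≢i (disjoint z∈Sj (proj₂ (covers zero)))))
      (sum-card (Vec.tail ∘ S) (λ v∈i v∈j → disjoint (∈-tail⁻ v∈i) (∈-tail⁻ v∈j))
        (λ v → let i , sv∈ = covers (suc v) in i , ∈-tail⁺ sv∈))))
    where
    bit : Side → ℕ
    bit inside  = 1
    bit outside = 0
    card-uncons : ∀ {n} (T : Subset (suc n)) → card T ≡ bit (Vec.head T) + card (Vec.tail T)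
    card-uncons (inside  ∷ T) = refl
    card-uncons (outside ∷ T) = refl
    bit-∈ : ∀ {n} {T : Subset (suc n)} → zero ∈ T → bit (Vec.head T) ≡ 1
    bit-∈ here = refl
    bit-∉ : ∀ {n} {T : Subset (suc n)} → zero ∉ T → bit (Vec.head T) ≡ 0
    bit-∉ {T = inside  ∷ T} z∉ = contradiction here z∉
    bit-∉ {T = outside ∷ T} z∉ = refl
    ∈-tail⁻ : ∀ {n} {v : Fin n} {T : Subset (suc n)} → v ∈ Vec.tail T → suc v ∈ T
    ∈-tail⁻ {T = _ ∷ T} = there
    ∈-tail⁺ : ∀ {n} {v : Fin n} {T : Subset (suc n)} → suc v ∈ T → v ∈ Vec.tail T
    ∈-tail⁺ (there v∈) = v∈

  -- The extreme case has one entry `r + 1` and all others `1`. The bound is `(r + 1)² + (k − 1)`,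
  -- expanded so as to cover `k = 0`. Merging the excess `h` of the first entry with the excess `r`
  -- of the rest gains `2hr`.
  sum-squares : ∀ {k} (s : Vector ℕ k) → (∀ i → 1 ≤ s i) →
                ∃[ r ] sum s ≡ k + r × sum (λ i → s i * s i) ≤ r * r + 2 * r + k
  sum-squares {zero}  s 1≤s = 0 , refl , z≤n
  sum-squares {suc k} s 1≤s with s zero | 1≤s zero | sum-squares (s ∘ suc) (1≤s ∘ suc)
  ... | suc h | _ | r , eq , le = h + r , trans (cong (suc h +_) eq) (eq₁ h k r) ,
    ≤-trans (+-monoʳ-≤ (suc h * suc h) le) (≤-trans (m≤m+n _ (2 * (h * r))) (≤-reflexive (eq₂ h k r)))
    where
    eq₁ : ∀ h k r → suc h + (k + r) ≡ suc k + (h + r)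
    eq₁ = solve-∀
    eq₂ : ∀ h k r → suc h * suc h + (r * r + 2 * r + k) + 2 * (h * r) ≡
                    (h + r) * (h + r) + 2 * (h + r) + suc k
    eq₂ = solve-∀

  -- Here `r + 1 = q`: the extreme sizes are `p` singletons and one part with `q` elements.
  partition-squares : ∀ {n p q} (S : Vector (Subset n) (suc p)) → IsPartition S → n ≡ p + q →
                      sum (λ i → card (S i)) ≡ p + q × sum (λ i → card (S i) * card (S i)) ≤ p + q * q
  partition-squares {n} {p} {q} S part n≡ = total , bound (sum-squares (λ i → card (S i)) (λ i → nonempty⇒1≤ (nonempty i)))
    where
    open IsPartition part
    total : sum (λ i → card (S i)) ≡ p + q
    total = trans (sum-card S disjoint covers) n≡
    nonempty⇒1≤ : ∀ {n} {T : Subset n} → Subset.Nonempty T → 1 ≤ card T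
    nonempty⇒1≤ {T = T} (v , v∈T) = subst (_≤ card T) (∣⁅x⁆∣≡1 v) (p⊆q⇒∣p∣≤∣q∣ λ w∈ → subst (_∈ T) (sym (x∈⁅y⁆⇒x≡y v w∈)) v∈T)
    bound : (∃[ r ] sum (λ i → card (S i)) ≡ suc p + r × sum (λ i → card (S i) * card (S i)) ≤ r * r + 2 * r + suc p) →
            sum (λ i → card (S i) * card (S i)) ≤ p + q * q
    bound (r , eq , le) = subst (λ q → sum (λ i → card (S i) * card (S i)) ≤ p + q * q) 1+r≡q (≤-trans le (≤-reflexive (sq p r)))
      where
      1+r≡q : suc r ≡ q
      1+r≡q = +-cancelˡ-≡ p (suc r) q (trans (+-suc p r) (trans (sym eq) total))
      sq : ∀ p r → r * r + 2 * r + suc p ≡ p + suc r * suc r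
      sq = solve-∀

  record Enumeration {n : ℕ} (H : Subset n) (p : ℕ) : Set where
    field
      elem       : Fin p → Fin n
      member     : ∀ i → elem i ∈ H
      injective  : ∀ {i j} → elem i ≡ elem j → i ≡ j
      surjective : ∀ {v} → v ∈ H → ∃[ i ] elem i ≡ v

  enumerate : ∀ {n} (H : Subset n) → Enumeration H (card H)
  enumerate []            = record
    { elem = λ () ; member = λ () ; injective = λ { {()} } ; surjective = λ () }
  enumerate (outside ∷ H) = record
    { elem       = λ i → suc (elem i)
    ; member     = λ i → there (member i)
    ; injective  = λ eq → injective (Fin.suc-injective eq)
    ; surjective = λ { (there v∈H) → let i , eq = surjective v∈H in i , cong suc eq }
    }
    where open Enumeration (enumerate H)
  enumerate (inside ∷ H)  = record
    { elem       = λ { zero → zero ; (suc i) → suc (elem i) }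
    ; member     = λ { zero → here ; (suc i) → there (member i) }
    ; injective  = λ { {zero} {zero} _ → refl ; {zero} {suc _} () ; {suc _} {zero} ()
                     ; {suc _} {suc _} eq → cong suc (injective (Fin.suc-injective eq)) }
    ; surjective = λ { here → zero , refl
                     ; (there v∈H) → let i , eq = surjective v∈H in suc i , cong suc eq }
    }
    where open Enumeration (enumerate H)

  module Planted {n p : ℕ} {H : Subset n} (enum : Enumeration H p) where
    open Enumeration enum

    planted : Vector (Subset n) (suc p)
    planted zero    = ∁ H
    planted (suc i) = ⁅ elem i ⁆

    planted-isPartition : Subset.Nonempty (∁ H) → IsPartition planted
    planted-isPartition ∁H≠∅ = record
      { nonempty = λ { zero → ∁H≠∅ ; (suc i) → elem i , x∈⁅x⁆ (elem i) }
      ; disjoint = disjoint _ _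
      ; covers   = covers
      }
      where
      disjoint : ∀ i j {v} → v ∈ planted i → v ∈ planted j → i ≡ j
      disjoint zero    zero    _ _ = refl
      disjoint zero    (suc j) v∈∁H v∈j = contradiction
        (subst (_∈ H) (sym (x∈⁅y⁆⇒x≡y _ v∈j)) (member j)) (x∈∁p⇒x∉p v∈∁H)
      disjoint (suc i) zero    v∈i v∈∁H = contradiction
        (subst (_∈ H) (sym (x∈⁅y⁆⇒x≡y _ v∈i)) (member i)) (x∈∁p⇒x∉p v∈∁H)
      disjoint (suc i) (suc j) v∈i v∈j =
        cong suc (injective (trans (sym (x∈⁅y⁆⇒x≡y _ v∈i)) (x∈⁅y⁆⇒x≡y _ v∈j)))
      covers : ∀ v → ∃[ i ] v ∈ planted i
      covers v with v ∈? H
      ... | no v∉H  = zero , x∉p⇒x∈∁p v∉H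
      ... | yes v∈H = let i , eq = surjective v∈H in
        suc i , subst (λ w → w ∈ ⁅ elem i ⁆) eq (x∈⁅x⁆ (elem i))

  module _ {n k : ℕ} (f : SetFunction n) where

    queried : Tree n k → List (Subset n)
    queried (output S)  = []
    queried (query S t) = S ∷ queried (t (f S))

    length-queried : ∀ t → length (queried t) ≡ queries f t
    length-queried (output S)  = refl
    length-queried (query S t) = cong suc (length-queried (t (f S)))

    -- Equal answers keep the run on the same path of the tree. Propositional equality is asked for
    -- because a continuation may distinguish representatives of one real.
    run-agree : ∀ g t → (∀ {S} → S List.∈ queried t → f S ≡ g S) → run g t ≡ run f t
    run-agree g (output S)  agree = refl
    run-agree g (query S t) agree = trans (cong (λ a → run g (t a)) (sym (agree (Any.here refl))))
      (run-agree g (t (f S)) (λ S∈ → agree (Any.there S∈)))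

  -- When `|H| = p`, the difference of `n |S ∩ H|` and `p |S|` is the deviation of `S`, so this
  -- places `S` in the dead zone; two inequalities avoid subtraction.
  Balanced : ∀ {n} → ℕ → ℕ → Subset n → Subset n → Set
  Balanced {n} p g H S = n * card (S ∩ H) ≤ p * card S + g × p * card S ≤ n * card (S ∩ H) + g

  module Hiding (c E L K : ℕ) .{{_ : NonZero E}} .{{_ : NonZero L}} .{{_ : NonZero K}}
    (E≡ : E ≡ suc (suc c)) (K≡ : K ≡ E * L * (E * L)) where

    open Concentration c E L K E≡ K≡

    -- The lower estimates are upper estimates for the complements.
    hide : ∀ u t (Ss : List (Subset (c * u * L + t))) →
           2 * length Ss * K ^ (2 * u) < suc K ^ (2 * u) →
           ∃[ H ] card H ≡ c * u × (∀ {S} → S List.∈ Ss → Balanced (c * u) (c * u * (u + t)) H S)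
    -- The `t` elements left over after the blocks stay outside `H`; they add at most `p t` to the
    -- error in either direction.
    hide u t Ss few = H₁ ++ ⊥ , cardH , balanced
      where
      p : ℕ
      p = c * u
      block : Subset (p * L + t) → Subset (p * L)
      block = take (p * L)
      both : List (Subset (p * L + t))
      both = Ss List.++ List.map ∁ Ss
      length-both : length both ≡ 2 * length Ss
      length-both = trans (List.length-++ Ss)
        (cong (length Ss +_) (trans (List.length-map ∁ Ss) (sym (+-identityʳ (length Ss)))))
      found = concentrated u (λ q → block (List.lookup both q))
        (subst (λ l → l * K ^ (2 * u) < suc K ^ (2 * u)) (sym length-both) few)
      H₁ : Subset (p * L)
      H₁ = proj₁ found
      cardH₁ : card H₁ ≡ p
      cardH₁ = proj₁ (proj₂ found)
      bound : ∀ {S} → S List.∈ both → L * card (block S ∩ H₁) ≤ card (block S) + u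
      bound S∈ = subst (λ S → L * card (block S ∩ H₁) ≤ card (block S) + u)
        (sym (lookup-index S∈)) (proj₂ (proj₂ found) (index S∈))
      cardH : card (H₁ ++ ⊥ {t}) ≡ p
      cardH = trans (card-++ H₁ ⊥) (trans (cong₂ _+_ cardH₁ (∣⊥∣≡0 t)) (+-identityʳ p))
      balanced : ∀ {S} → S List.∈ Ss → Balanced p (p * (u + t)) (H₁ ++ ⊥) S
      balanced {S} S∈ = upper , lower
        where
        open ≤-Reasoning
        S₁ : Subset (p * L)
        S₁ = block S
        S₂ : Subset t
        S₂ = drop (p * L) S
        S≡ : S₁ ++ S₂ ≡ S
        S≡ = take++drop≡id (p * L) S
        b b′ s₁ s₁′ s₂ : ℕ
        b   = card (S₁ ∩ H₁)
        b′  = card (∁ S₁ ∩ H₁)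
        s₁  = card S₁
        s₁′ = card (∁ S₁)
        s₂  = card S₂
        card-S∩H : card (S ∩ (H₁ ++ ⊥)) ≡ b
        card-S∩H = trans (cong (λ T → card (T ∩ (H₁ ++ ⊥))) (sym S≡))
          (trans (card-∩-++ S₁ H₁ S₂ ⊥)
          (trans (cong (b +_) (trans (cong card (∩-zeroʳ S₂)) (∣⊥∣≡0 t))) (+-identityʳ b)))
        card-S : card S ≡ s₁ + s₂
        card-S = trans (cong card (sym S≡)) (card-++ S₁ S₂)
        b+b′ : b′ + b ≡ p
        b+b′ = trans (card-∩-∁ S₁ H₁) cardH₁
        b≤p : b ≤ p
        b≤p = subst (b ≤_) b+b′ (m≤n+m b b′)
        bound₁ : L * b ≤ s₁ + u
        bound₁ = bound (List.∈-++⁺ˡ S∈)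
        bound₂ : L * b′ ≤ s₁′ + u
        bound₂ = subst (λ T → L * card (T ∩ H₁) ≤ card T + u) block-∁
          (bound (List.∈-++⁺ʳ Ss (List.∈-map⁺ ∁ S∈)))
          where
          block-∁ : block (∁ S) ≡ ∁ S₁
          block-∁ = trans (cong (λ T → block (∁ T)) (sym S≡))
            (trans (cong block (map-++ _ S₁ S₂)) (take-++ (∁ S₁) (∁ S₂)))
            where
            take-++ : ∀ {m n} (T : Subset m) (U : Subset n) → take m (T ++ U) ≡ T
            take-++ []      U = refl
            take-++ (x ∷ T) U = cong (x ∷_) (take-++ T U)
        upper : (p * L + t) * card (S ∩ (H₁ ++ ⊥)) ≤ p * card S + p * (u + t)
        upper = begin
          (p * L + t) * card (S ∩ (H₁ ++ ⊥)) ≡⟨ cong ((p * L + t) *_) card-S∩H ⟩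
          (p * L + t) * b                    ≡⟨ eq₁ p L t b ⟩
          p * (L * b) + b * t                ≤⟨ +-mono-≤ (*-monoʳ-≤ p bound₁) (*-monoˡ-≤ t b≤p) ⟩
          p * (s₁ + u) + p * t               ≤⟨ m≤m+n _ (p * s₂) ⟩
          p * (s₁ + u) + p * t + p * s₂      ≡⟨ eq₂ p s₁ s₂ u t ⟩
          p * (s₁ + s₂) + p * (u + t)        ≡⟨ cong (λ s → p * s + p * (u + t)) card-S ⟨
          p * card S + p * (u + t)           ∎
          where
          eq₁ : ∀ p L t b → (p * L + t) * b ≡ p * (L * b) + b * t
          eq₁ = solve-∀
          eq₂ : ∀ p s₁ s₂ u t → p * (s₁ + u) + p * t + p * s₂ ≡ p * (s₁ + s₂) + p * (u + t)
          eq₂ = solve-∀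
        lower : p * card S ≤ (p * L + t) * card (S ∩ (H₁ ++ ⊥)) + p * (u + t)
        -- Adding `p * s₁′` on both sides expresses `s₁` through the complement, where the second
        -- bound applies.
        lower = +-cancelˡ-≤ (p * s₁′) _ _ (begin
          p * s₁′ + p * card S                                ≡⟨ cong (λ s → p * s₁′ + p * s) card-S ⟩
          p * s₁′ + p * (s₁ + s₂)                             ≡⟨ eq₁ p s₁ s₁′ s₂ ⟩
          p * (s₁′ + s₁) + p * s₂                             ≡⟨ cong (λ m → p * m + p * s₂) (trans (card-∁ S₁) (cong (_* L) (sym b+b′))) ⟩
          p * ((b′ + b) * L) + p * s₂                         ≡⟨ eq₂ p b b′ L s₂ ⟩
          p * (L * b′) + (p * L * b + p * s₂)                 ≤⟨ +-mono-≤ (*-monoʳ-≤ p bound₂) (+-monoʳ-≤ (p * L * b) (*-monoʳ-≤ p (∣p∣≤n S₂))) ⟩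
          p * (s₁′ + u) + (p * L * b + p * t)                 ≤⟨ m≤m+n _ (t * b) ⟩
          p * (s₁′ + u) + (p * L * b + p * t) + t * b         ≡⟨ eq₃ p L t b s₁′ u ⟩
          p * s₁′ + ((p * L + t) * b + p * (u + t))           ≡⟨ cong (λ b → p * s₁′ + ((p * L + t) * b + p * (u + t))) card-S∩H ⟨
          p * s₁′ + ((p * L + t) * card (S ∩ (H₁ ++ ⊥)) + p * (u + t)) ∎)
          where
          eq₁ : ∀ p s s′ s₂ → p * s′ + p * (s + s₂) ≡ p * (s′ + s) + p * s₂
          eq₁ = solve-∀
          eq₂ : ∀ p b b′ L s → p * ((b′ + b) * L) + p * s ≡ p * (L * b′) + (p * L * b + p * s)
          eq₂ = solve-∀
          eq₃ : ∀ p L t b s u → p * (s + u) + (p * L * b + p * t) + t * b ≡ p * s + ((p * L + t) * b + p * (u + t))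
          eq₃ = solve-∀

-- Integer costs and the gap between the two optima

module IntegerCosts where

  open DeadZones
  open HardFunctions
  open Partitions using (partition-squares)
  open import Data.Empty using (⊥)
  open import Data.Fin.Base using (zero; suc)
  open import Data.Fin.Subset using (Subset) renaming (∣_∣ to card)
  open import Data.Integer.Base hiding (suc)
  open import Data.Integer.Properties
  open import Data.Integer.Tactic.RingSolver using (solve-∀)
  open import Data.Nat.Base as ℕ using (ℕ; suc; zero)
  import Data.Nat.Properties as ℕ
  open import Algebra.Properties.Semiring.Sum ℕ.+-*-semiring using (sum)
  open import Data.Product.Base using (_×_; _,_; ∃-syntax)
  open import Data.Vec.Functional using (Vector; foldr)
  open import Function.Base using (_∘_)
  open import Relation.Binary.PropositionalEquality
  open import Relation.Nullary using (¬_)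

  sumℤ : ∀ {k} → Vector ℤ k → ℤ
  sumℤ = foldr _+_ 0ℤ

  sumℤ-cong : ∀ {k} {x y : Vector ℤ k} → (∀ i → x i ≡ y i) → sumℤ x ≡ sumℤ y
  sumℤ-cong {zero}  eq = refl
  sumℤ-cong {suc k} eq = cong₂ _+_ (eq zero) (sumℤ-cong (eq ∘ suc))

  sumℤ-nonneg : ∀ {k} {x : Vector ℤ k} → (∀ i → 0ℤ ≤ x i) → 0ℤ ≤ sumℤ x
  sumℤ-nonneg {zero}  le = ≤-refl
  sumℤ-nonneg {suc k} le = +-mono-≤ (le zero) (sumℤ-nonneg (le ∘ suc))

  sumℤ-≤-const : ∀ {k} {x : Vector ℤ k} c → (∀ i → x i ≤ c) → sumℤ x ≤ + k * c
  sumℤ-≤-const {zero}  c le = ≤-refl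
  sumℤ-≤-const {suc k} c le = ≤-trans (+-mono-≤ (le zero) (sumℤ-≤-const c (le ∘ suc))) (≤-reflexive (eq c (+ k)))
    where
    eq : ∀ c k → c + k * c ≡ (1ℤ + k) * c
    eq = solve-∀

  -- Doubly negated, to avoid a search over all partitions.
  minimum-¬¬ : ∀ {T : Set} (cost : T → ℤ) (P : T → Set) → (∀ t → 0ℤ ≤ cost t) → ∀ t → P t →
               ¬ ¬ (∃[ s ] P s × ∀ r → P r → cost s ≤ cost r)
  minimum-¬¬ cost P nonneg t Pt none = below ∣ cost t ∣ t Pt (≤-reflexive (sym (0≤i⇒+∣i∣≡i (nonneg t))))
    where
    -- Descent on a bound for the cost: anything strictly cheaper satisfies the next smaller bound.
    below : ∀ m s → P s → ¬ (cost s ≤ + m)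
    below m s Ps le = none (s , Ps , λ r Pr → ≮⇒≥ (smaller m le r Pr))
      where
      smaller : ∀ m → cost s ≤ + m → ∀ r → P r → ¬ (cost r < cost s)
      smaller zero    le r Pr lt = <⇒≱ (<-≤-trans lt le) (nonneg r)
      smaller (suc m) le r Pr lt = below m r Pr (i<j⇒i≤pred[j] (<-≤-trans lt le))

  module Gap (p q : ℕ) where

    -- As `φ` is quadratic, the cost depends only on the sum of the sizes and the sum of their
    -- squares.
    sumℤ-φ : ∀ {k} (s : Vector ℕ k) → sumℤ (λ i → φ p q (+ s i)) ≡
             + p * + q * ((+ p + + q) * + sum s - + sum (λ i → s i ℕ.* s i))
    sumℤ-φ {zero}  s = eq (+ p) (+ q)
      where
      eq : ∀ P Q → 0ℤ ≡ P * Q * ((P + Q) * 0ℤ - 0ℤ)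
      eq = solve-∀
    sumℤ-φ {suc k} s = trans (cong (λ m → φ p q (+ s zero) + m) (sumℤ-φ (s ∘ suc)))
      (trans (eq (+ p) (+ q) (+ s zero) (+ sum (s ∘ suc)) (+ sum (λ i → s (suc i) ℕ.* s (suc i))))
        (cong (λ sq → + p * + q * ((+ p + + q) * (+ s zero + + sum (s ∘ suc)) - (sq + + sum (λ i → s (suc i) ℕ.* s (suc i)))))
          (sym (pos-* (s zero) (s zero)))))
      where
      eq : ∀ P Q s m r → P * Q * (s * (P + Q - s)) + P * Q * ((P + Q) * m - r) ≡
                         P * Q * ((P + Q) * (s + m) - (s * s + r))
      eq = solve-∀

    -- At `R = pq`, `lower` is the cost under `φ` of `p` singletons and one part of `q` elements.
    -- `upper` adds the bound for the complement of `H` to `p` singletons.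
    lower upper : ℤ → ℤ
    lower R = R * ((+ p + + q) * (+ p + + q) - (+ p + + q * + q))
    upper g = + 2 * (+ p * + q) * g + + p * φ p q 1ℤ

    partition-lower : ∀ {n} (S : Vector (Subset n) (suc p)) → IsPartition S → n ≡ p ℕ.+ q →
                      lower (+ p * + q) ≤ sumℤ (λ i → φ p q (+ card (S i)))
    partition-lower S part n≡ = let total , squares = partition-squares S part n≡ in
      ≤-trans
        (*-monoˡ-≤-nonNeg (+ p * + q) {{nonNegative (*-nonneg {+ p} {+ q} (+≤+ ℕ.z≤n) (+≤+ ℕ.z≤n))}}
          (+-mono-≤ (≤-reflexive (cong (λ m → (+ p + + q) * + m) (sym total)))
            (neg-mono-≤ (≤-trans (+≤+ squares) (≤-reflexive (cong (λ m → + p + m) (pos-* q q)))))))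
        (≤-reflexive (sym (sumℤ-φ (λ i → card (S i)))))

    -- Put `D = d + 1`, `n = p + q` and `u = t + e`, which builds in `t ≤ u`. Then
    -- `D lower − (2D − 1) upper` is `p²q` times `n − D p + D − 1 − (4D − 2)(u + t)`. Since
    -- `n = 2Dp + t` and `p = 16u`, the gain `D p = 16Du` outweighs the loss, which is at most
    -- `(8D − 4) u`, and the total exceeds the `1` that the last hypothesis allows.
    contradictory : ∀ d t e {X Y} → p ≡ 16 ℕ.* (t ℕ.+ e) → p ℕ.+ q ≡ p ℕ.* (2 ℕ.* suc d) ℕ.+ t →
      1 ℕ.≤ t ℕ.+ e → 1 ℕ.≤ q → lower (+ p * + q) ≤ X → Y ≤ upper (+ (p ℕ.* (t ℕ.+ e ℕ.+ t))) →
      + suc d * X ≤ (+ 2 * + suc d - 1ℤ) * Y + 1ℤ → ⊥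
    contradictory d t e {X} {Y} p≡ p+q≡ 1≤u 1≤q lo up le = <⇒≱ 1<excess excess≤1
      where
      P Q D T e′ c g r excess : ℤ
      P = + p
      Q = + q
      D = + suc d
      T = + t
      e′ = + e
      c = + 2 * D - 1ℤ
      g = + (p ℕ.* (t ℕ.+ e ℕ.+ t))
      -- The first summand is at least `8` by `1 ≤ u`; all coefficients in the second are
      -- nonnegative.
      r = + 8 * (T + e′) + (+ 8 * + d * T + (+ 4 + + 12 * + d) * e′ + + 5 * T + + 2 * e′ + + d)
      excess = P * Q * P * r
      1≤c : 1ℤ ≤ c
      1≤c = ≤-by (+ 2 * + d) (*-nonneg {+ 2} {+ d} (+≤+ ℕ.z≤n) (+≤+ ℕ.z≤n)) (eq (+ d))
        where
        eq : ∀ d → + 2 * d ≡ + 2 * (1ℤ + d) - 1ℤ - 1ℤ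
        eq = solve-∀
      P≡ : P ≡ + 16 * (T + e′)
      P≡ = trans (cong +_ p≡) (pos-* 16 (t ℕ.+ e))
      P+Q≡ : P + Q ≡ P * (+ 2 * D) + T
      P+Q≡ = trans (cong +_ p+q≡) (cong (_+ T) (trans (pos-* p (2 ℕ.* suc d)) (cong (P *_) (pos-* 2 (suc d)))))
      excess≡ : D * lower (P * Q) - c * upper g ≡ excess
      excess≡ = begin
        D * lower (P * Q) - c * upper g
          ≡⟨ cong (λ g → D * lower (P * Q) - c * upper g) (pos-* p (t ℕ.+ e ℕ.+ t)) ⟩
        D * lower (P * Q) - c * upper (P * (T + e′ + T))
          ≡⟨ eq₁ P Q D (T + e′ + T) ⟩
        P * Q * P * (P + Q - D * P + D - 1ℤ - (+ 4 * D - + 2) * (T + e′ + T))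
          ≡⟨ cong (λ n → P * Q * P * (n - D * P + D - 1ℤ - (+ 4 * D - + 2) * (T + e′ + T))) P+Q≡ ⟩
        P * Q * P * (P * (+ 2 * D) + T - D * P + D - 1ℤ - (+ 4 * D - + 2) * (T + e′ + T))
          ≡⟨ cong (λ k → P * Q * P * (k * (+ 2 * D) + T - D * k + D - 1ℤ - (+ 4 * D - + 2) * (T + e′ + T))) P≡ ⟩
        P * Q * P * (+ 16 * (T + e′) * (+ 2 * D) + T - D * (+ 16 * (T + e′)) + D - 1ℤ - (+ 4 * D - + 2) * (T + e′ + T))
          ≡⟨ cong (P * Q * P *_) (eq₂ T e′ (+ d)) ⟩
        excess ∎
        where
        open ≡-Reasoning
        eq₁ : ∀ P Q D G →
          D * (P * Q * ((P + Q) * (P + Q) - (P + Q * Q)))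
          - (+ 2 * D - 1ℤ) * (+ 2 * (P * Q) * (P * G) + P * (P * Q * (1ℤ * (P + Q - 1ℤ))))
          ≡ P * Q * P * (P + Q - D * P + D - 1ℤ - (+ 4 * D - + 2) * G)
        eq₁ = solve-∀
        eq₂ : ∀ T e d →
          + 16 * (T + e) * (+ 2 * (1ℤ + d)) + T - (1ℤ + d) * (+ 16 * (T + e)) + (1ℤ + d) - 1ℤ
          - (+ 4 * (1ℤ + d) - + 2) * (T + e + T)
          ≡ + 8 * (T + e) + (+ 8 * d * T + (+ 4 + + 12 * d) * e + + 5 * T + + 2 * e + d)
        eq₂ = solve-∀
      excess≤1 : excess ≤ 1ℤ
      excess≤1 = subst (_≤ 1ℤ) excess≡ (≤-trans
        (+-mono-≤ (*-monoˡ-≤-nonNeg D lo) (neg-mono-≤ (*-monoˡ-≤-nonNeg c {{nonNegative (≤-trans (+≤+ ℕ.z≤n) 1≤c)}} up)))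
        (≤-trans (+-monoˡ-≤ (- (c * Y)) le) (≤-reflexive (eq (c * Y)))))
        where
        eq : ∀ y → y + 1ℤ - y ≡ 1ℤ
        eq = solve-∀
      *-expand : ∀ {i j} → 1ℤ ≤ i → 0ℤ ≤ j → j ≤ i * j
      *-expand {i} {j} 1≤i 0≤j = ≤-by ((i - 1ℤ) * j) (*-nonneg (i≤j⇒0≤j-i 1≤i) 0≤j) (eq i j)
        where
        eq : ∀ i j → (i - 1ℤ) * j ≡ i * j - j
        eq = solve-∀
      1≤P : 1ℤ ≤ P
      1≤P = +≤+ (subst (1 ℕ.≤_) (sym p≡) (ℕ.≤-trans 1≤u (ℕ.m≤m+n (t ℕ.+ e) _)))
      1≤PQP : 1ℤ ≤ P * Q * P
      1≤PQP = ≤-trans 1≤P (*-expand (≤-trans (+≤+ 1≤q) (*-expand 1≤P (+≤+ ℕ.z≤n))) (+≤+ ℕ.z≤n))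
      0≤ : ∀ m → 0ℤ ≤ + m
      0≤ m = +≤+ ℕ.z≤n
      8≤r : + 8 ≤ r
      8≤r = +-mono-≤ {+ 8} {_} {0ℤ} (*-monoˡ-≤-nonNeg (+ 8) (+≤+ 1≤u))
        (+-mono-≤ (+-mono-≤ (+-mono-≤ (+-mono-≤
          (*-nonneg (*-nonneg (0≤ 8) (0≤ d)) (0≤ t))
          (*-nonneg (+-mono-≤ (0≤ 4) (*-nonneg (0≤ 12) (0≤ d))) (0≤ e)))
          (*-nonneg (0≤ 5) (0≤ t))) (*-nonneg (0≤ 2) (0≤ e))) (0≤ d))
      1<excess : 1ℤ < excess
      1<excess = <-≤-trans (+<+ (ℕ.s≤s (ℕ.s≤s ℕ.z≤n))) (≤-trans 8≤r (*-expand 1≤PQP (≤-trans (0≤ 8) 8≤r)))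

-- Transfer between integers, rationals and reals

module RationalValues where

  open IntegerCosts using (sumℤ)
  open import Data.Fin.Base using (zero; suc)
  open import Data.Fin.Subset using (Subset)
  open import Data.Integer.Base as ℤ using (ℤ; +_; 0ℤ; 1ℤ)
  import Data.Integer.Properties as ℤ
  open import Data.Integer.Tactic.RingSolver using (solve-∀)
  open import Data.Nat.Base as ℕ using (ℕ; suc; zero)
  open import Data.Nat.Coprimality using (1-coprimeTo) renaming (sym to coprime-sym)
  import Data.Nat.Properties as ℕ
  open import Data.Product.Base using (_×_; _,_; ∃-syntax)
  open import Data.Rational.Base
  open import Data.Rational.Properties
  open import Data.Rational.Solver using (module +-*-Solver)
  import Data.Rational.Unnormalised.Base as ℚᵘ
  import Data.Rational.Unnormalised.Properties as ℚᵘ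
  open import Data.Vec.Functional using (Vector)
  open import Function.Base using (_∘_)
  open import Relation.Binary.PropositionalEquality

  -- Built by `mkℚ` rather than normalised by `_/_`, so that numerator and denominator are visible
  -- for a variable `i`.
  ι : ℤ → ℚ
  ι i = mkℚ i 0 (coprime-sym (1-coprimeTo ℤ.∣ i ∣))

  ι-+ : ∀ i j → ι (i ℤ.+ j) ≡ ι i + ι j
  ι-+ i j = toℚᵘ-injective (ℚᵘ.≃-trans (ℚᵘ.*≡* (eq i j)) (ℚᵘ.≃-sym (toℚᵘ-homo-+ (ι i) (ι j))))
    where
    eq : ∀ i j → (i ℤ.+ j) ℤ.* 1ℤ ≡ (i ℤ.* 1ℤ ℤ.+ j ℤ.* 1ℤ) ℤ.* 1ℤ
    eq = solve-∀

  ι-* : ∀ i j → ι (i ℤ.* j) ≡ ι i * ι j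
  ι-* i j = toℚᵘ-injective (ℚᵘ.≃-sym (toℚᵘ-homo-* (ι i) (ι j)))

  ι-neg : ∀ i → ι (ℤ.- i) ≡ - ι i
  ι-neg i = toℚᵘ-injective (ℚᵘ.≃-sym (toℚᵘ-homo‿- (ι i)))

  ι-mono : ∀ {i j} → i ℤ.≤ j → ι i ≤ ι j
  ι-mono {i} {j} i≤j = *≤* (subst₂ ℤ._≤_ (sym (ℤ.*-identityʳ i)) (sym (ℤ.*-identityʳ j)) i≤j)

  ι-reflect : ∀ {i j} → ι i ≤ ι j → i ℤ.≤ j
  ι-reflect {i} {j} (*≤* i≤j) = subst₂ ℤ._≤_ (ℤ.*-identityʳ i) (ℤ.*-identityʳ j) i≤j

  ≤ℝ-pointwise : ∀ {x y} → (∀ m → seq x m ≤ seq y m) → x ≤ℝ y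
  ≤ℝ-pointwise {x} {y} le δ 0<δ = 0 , λ m _ →
    ≤-trans (le m) (≤-trans (≤-reflexive (sym (+-identityʳ (seq y m)))) (+-monoʳ-≤ (seq y m) (<⇒≤ 0<δ)))

  toℝ : ℤ → ℝ
  toℝ i = fromℚ (ι i)

  -- Costs of integer-valued functions are constant sequences, which reduces comparisons of real
  -- costs to integer ones.
  seq-cost : ∀ {n k} (F : Subset n → ℤ) (T : Vector (Subset n) k) m →
             seq (cost (λ S → toℝ (F S)) T) m ≡ ι (sumℤ (λ i → F (T i)))
  seq-cost {k = zero}  F T m = refl
  seq-cost {k = suc k} F T m =
    trans (cong (λ r → ι (F (T zero)) + r) (seq-cost F (T ∘ suc) m)) (sym (ι-+ (F (T zero)) _))

  -- For `δ = (a + 1)/(d + 1)` the unit fraction `1/(d + 1)` already works.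
  archimedean : ∀ δ → 0ℚ < δ → ∃[ d ] ∃[ η ] 0ℚ < η × η ≤ δ × ι (+ suc d) * η ≡ 1ℚ
  archimedean δ@(mkℚ (+ suc a) d _) 0<δ = d , η ,
    *<* (ℤ.+<+ (ℕ.s≤s ℕ.z≤n)) ,
    *≤* (ℤ.*-monoʳ-≤-nonNeg (+ suc d) (ℤ.+≤+ (ℕ.s≤s (ℕ.z≤n {a})))) ,
    toℚᵘ-injective (ℚᵘ.≃-trans (toℚᵘ-homo-* (ι (+ suc d)) η) (ℚᵘ.*≡* (eq (+ suc d))))
    where
    η : ℚ
    η = mkℚ 1ℤ d (1-coprimeTo (suc d))
    eq : ∀ x → x ℤ.* 1ℤ ℤ.* 1ℤ ≡ 1ℤ ℤ.* (1ℤ ℤ.* x)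
    eq = solve-∀
  archimedean (mkℚ (+ zero) d _) (*<* (ℤ.+<+ ()))
  archimedean (mkℚ ℤ.-[1+ a ] d _) (*<* ())

  -- The real inequality is used with tolerance `η`, at an index late enough for `η ≤ ε`; `0 ≤ Y`
  -- then lets `η` replace `ε`. Multiplying by `D = 1/η` turns `2 − η` into `2D − 1` and the
  -- tolerance into the final `1`.
  ratio-bound : ∀ d {η} ε X Y x y → 0ℚ < η → ι (+ suc d) * η ≡ 1ℚ →
    ∃[ N ] (∀ m → N ℕ.≤ m → η ≤ seq ε m) → 0ℤ ℤ.≤ Y →
    (∀ m → seq x m ≡ ι X) → (∀ m → seq y m ≡ ι Y) → x ≤ℝ (2ℝ -ℝ ε) *ℝ y →
    + suc d ℤ.* X ℤ.≤ (+ 2 ℤ.* + suc d ℤ.- 1ℤ) ℤ.* Y ℤ.+ 1ℤ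
  ratio-bound d {η} ε X Y x y 0<η Dη≡1 (N , η≤ε) 0≤Y x≡ y≡ le with le η 0<η
  ... | M , x≤ = ι-reflect (begin
    ι (D ℤ.* X)                                 ≡⟨ ι-* D X ⟩
    ι D * ι X                                   ≡⟨ cong (ι D *_) (x≡ m) ⟨
    ι D * seq x m                               ≤⟨ *-monoˡ-≤-nonNeg (ι D) (x≤ m (ℕ.m≤n⊔m N M)) ⟩
    ι D * ((2ℚ - seq ε m) * seq y m + η)        ≡⟨ cong (λ y → ι D * ((2ℚ - seq ε m) * y + η)) (y≡ m) ⟩
    ι D * ((2ℚ - seq ε m) * ι Y + η)            ≤⟨ *-monoˡ-≤-nonNeg (ι D) (+-monoˡ-≤ η
                                                     (*-monoʳ-≤-nonNeg (ι Y) {{nonNegative (ι-mono 0≤Y)}}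
                                                     (+-monoʳ-≤ 2ℚ (neg-antimono-≤ (η≤ε m (ℕ.m≤m⊔n N M)))))) ⟩
    ι D * ((2ℚ - η) * ι Y + η)                  ≡⟨ eq (ι D) η (ι Y) 2ℚ ⟩
    (2ℚ * ι D - ι D * η) * ι Y + ι D * η        ≡⟨ cong (λ r → (2ℚ * ι D - r) * ι Y + r) Dη≡1 ⟩
    (2ℚ * ι D - 1ℚ) * ι Y + 1ℚ                  ≡⟨ cong (_+ 1ℚ) (trans (ι-* c Y) (cong (_* ι Y)
                                                     (trans (ι-+ (+ 2 ℤ.* D) (ℤ.- 1ℤ))
                                                     (cong₂ _+_ (ι-* (+ 2) D) refl)))) ⟨
    ι (c ℤ.* Y) + ι 1ℤ                          ≡⟨ ι-+ (c ℤ.* Y) 1ℤ ⟨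
    ι (c ℤ.* Y ℤ.+ 1ℤ)                          ∎)
    where
    open ≤-Reasoning
    m : ℕ
    m = N ℕ.⊔ M
    D c : ℤ
    D = + suc d
    c = + 2 ℤ.* D ℤ.- 1ℤ
    2ℚ : ℚ
    2ℚ = + 2 / 1
    eq : ∀ D η Y t → D * ((t - η) * Y + η) ≡ (t * D - D * η) * Y + D * η
    eq = solve 4 (λ D η Y t → D :* ((t :- η) :* Y :+ η) := (t :* D :- D :* η) :* Y :+ D :* η) refl
      where open +-*-Solver

open DeadZones using (≤-by)
open HardFunctions
open BlockSampling using (pow-lower; ^-distribʳ-*)
open Partitions
open IntegerCosts
open RationalValues
open import Data.Empty using (⊥)
open import Data.Fin.Subset as Subset using (Subset; ∁; ⁅_⁆; _∩_; _∪_) renaming (∣_∣ to card)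
open import Data.Fin.Subset.Properties using (∣⁅x⁆∣≡1; ∣p∩q∣≤∣q∣; ∣∁p∣≡n∸∣p∣; nonempty?; Empty-unique; ∣⊥∣≡0)
open import Data.Integer.Base as ℤ using (ℤ; +_; 1ℤ)
import Data.Integer.Properties as ℤ
import Data.Integer.Tactic.RingSolver as ℤ-Solver
open import Data.List.Base as List using (List; []; length)
import Data.List.Membership.Propositional as List
import Data.List.Membership.Propositional.Properties as List
import Data.List.Properties as List
open import Data.Nat.Base as ℕ using (ℕ; suc; _+_; _*_; _^_; _∸_; _≤_; _<_; NonZero)
open import Data.Nat.DivMod using (_/_; _%_; /-mono-≤; m*n/n≡m; m%n<n; m≡m%n+[m/n]*n)
open import Data.Nat.Properties
open import Data.Nat.Tactic.RingSolver using (solve-∀)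
open import Data.Product.Base using (_×_; _,_; ∃-syntax; proj₁; proj₂)
import Data.Rational.Base as ℚ
open import Data.Rational.Base using (ℚ; 0ℚ; 1ℚ)
import Data.Rational.Properties as ℚ
open import Data.Vec.Functional using (Vector)
open import Function.Base using (case_of_)
open import Relation.Binary.PropositionalEquality
open import Relation.Nullary using (contradiction; yes; no)

-- The hard functions as real-valued instances

module Instance {n : ℕ} (H : Subset n) (g : ℕ) where
  open Hard H g

  f : SetFunction n
  f S = toℝ (F S)

  f-isInstance : IsInstance f
  f-isInstance = record
    { nonNegative = λ S → ≤ℝ-pointwise {0ℝ} {f S} λ _ → ι-mono (F-nonneg S)
    ; symmetric   = λ S →
        ≤ℝ-pointwise {f S} {f (∁ S)} (λ _ → ι-mono (ℤ.≤-reflexive (sym (F-sym S)))) ,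
        ≤ℝ-pointwise {f (∁ S)} {f S} (λ _ → ι-mono (ℤ.≤-reflexive (F-sym S)))
    ; submodular  = λ A B v A⊆B v∉B →
        ≤ℝ-pointwise {f (B ∪ ⁅ v ⁆) -ℝ f B} {f (A ∪ ⁅ v ⁆) -ℝ f A} λ _ →
          subst₂ ℚ._≤_ (ι-- (F (B ∪ ⁅ v ⁆)) (F B)) (ι-- (F (A ∪ ⁅ v ⁆)) (F A))
            (ι-mono (F-submodular A B v A⊆B v∉B))
    }
    where
    ι-- : ∀ i j → ι (i ℤ.- j) ≡ ι i ℚ.- ι j
    ι-- i j = trans (ι-+ i (ℤ.- j)) (cong (ι i ℚ.+_) (ι-neg j))

  private
    P+Q≡n : card (∁ H) + card H ≡ n
    P+Q≡n = card-∁ H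

  F-flat : ∀ {S} → card (∁ H) * card (S ∩ H) ≤ card H * card (S ∩ ∁ H) + g →
           card H * card (S ∩ ∁ H) ≤ card (∁ H) * card (S ∩ H) + g →
           F S ≡ φ (card H) (card (∁ H)) (+ card S)
  F-flat {S} le ge = F-inZone S (lo , hi)
    where
    a b p q : ℕ
    a = card (S ∩ ∁ H)
    b = card (S ∩ H)
    p = card H
    q = card (∁ H)
    cast : ∀ {w x y z} → w * x ≤ y * z + g → + w ℤ.* + x ℤ.≤ + y ℤ.* + z ℤ.+ + g
    cast {w} {x} {y} {z} h = subst₂ ℤ._≤_ (ℤ.pos-* w x) (cong (ℤ._+ + g) (ℤ.pos-* y z)) (ℤ.+≤+ h)
    lo : ℤ.- + g ℤ.≤ + q ℤ.* + b ℤ.- + p ℤ.* + a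
    lo = ≤-by _ (ℤ.i≤j⇒0≤j-i (cast {p} {a} {q} {b} ge)) (eq (+ q ℤ.* + b) (+ p ℤ.* + a) (+ g))
      where
      eq : ∀ x y g → x ℤ.+ g ℤ.- y ≡ x ℤ.- y ℤ.- ℤ.- g
      eq = ℤ-Solver.solve-∀
    hi : + q ℤ.* + b ℤ.- + p ℤ.* + a ℤ.≤ + g
    hi = ≤-by _ (ℤ.i≤j⇒0≤j-i (cast {q} {b} {p} {a} le)) (eq (+ q ℤ.* + b) (+ p ℤ.* + a) (+ g))
      where
      eq : ∀ x y g → y ℤ.+ g ℤ.- x ≡ g ℤ.- (x ℤ.- y)
      eq = ℤ-Solver.solve-∀

  -- Cancelling `p b` turns the comparison of `n b` with `p (a + b)` into that of `q b` with `p a`.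
  F-balanced : ∀ {S} → n * card (S ∩ H) ≤ card H * card S + g →
               card H * card S ≤ n * card (S ∩ H) + g →
               F S ≡ φ (card H) (card (∁ H)) (+ card S)
  F-balanced {S} le ge = F-flat {S}
    (+-cancelˡ-≤ (p * b) _ _ (subst₂ _≤_ (trans (cong (_* b) (sym P+Q≡n)) (eq₁ q p b))
      (trans (cong (λ s → p * s + g) (sym (card-split S H))) (eq₂ p a b g)) le))
    (+-cancelˡ-≤ (p * b) _ _ (subst₂ _≤_ (trans (cong (p *_) (sym (card-split S H))) (eq₃ p a b))
      (trans (cong (λ m → m * b + g) (sym P+Q≡n)) (eq₄ q p b g)) ge))
    where
    a b p q : ℕ
    a = card (S ∩ ∁ H)
    b = card (S ∩ H)
    p = card H
    q = card (∁ H)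
    eq₁ : ∀ q p b → (q + p) * b ≡ p * b + q * b
    eq₁ = solve-∀
    eq₂ : ∀ p a b g → p * (a + b) + g ≡ p * b + (p * a + g)
    eq₂ = solve-∀
    eq₃ : ∀ p a b → p * (a + b) ≡ p * b + p * a
    eq₃ = solve-∀
    eq₄ : ∀ q p b g → (q + p) * b + g ≡ p * b + (q * b + g)
    eq₄ = solve-∀

-- The adversary argument for one ground set

module Lower (d E L K : ℕ) .{{_ : NonZero E}} .{{_ : NonZero L}} .{{_ : NonZero K}}
  (L≡ : L ≡ 2 * suc d) (E≡ : E ≡ 18) (K≡ : K ≡ E * L * (E * L))
  (ε : ℝ) {η : ℚ} (0<η : 0ℚ ℚ.< η) (Dη≡1 : ι (+ suc d) ℚ.* η ≡ 1ℚ)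
  (η≤ε : ∃[ N ] (∀ m → N ≤ m → η ℚ.≤ seq ε m)) where

  -- The choice `c = 16` gives `p = 16 u`, as the gap computation requires, and `E = c + 2 = 18`.
  open Hiding 16 E L K E≡ K≡

  module Blocks (u t : ℕ) (t≤u : t ≤ u) (1≤u : 1 ≤ u) (threshold : 0 < suc K ^ (2 * u)) where

    p n : ℕ
    p = 16 * u
    n = p * L + t

    1≤p : 1 ≤ p
    1≤p = ≤-trans 1≤u (m≤m+n u _)

    q : ℕ
    q = n ∸ p

    p+t+p≤n : p + t + p ≤ n
    p+t+p≤n = begin
      p + t + p    ≡⟨ eq p t ⟩
      p * 2 + t    ≤⟨ +-monoˡ-≤ t (*-monoʳ-≤ p (subst (2 ≤_) (sym L≡) (*-monoʳ-≤ 2 (ℕ.s≤s ℕ.z≤n)))) ⟩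
      p * L + t    ∎
      where
      open ≤-Reasoning
      eq : ∀ p t → p + t + p ≡ p * 2 + t
      eq = solve-∀

    p+q≡n : p + q ≡ n
    p+q≡n = m+[n∸m]≡n (≤-trans (m≤n+m p (p + t)) p+t+p≤n)

    p+t≤q : p + t ≤ q
    p+t≤q = m+n≤o⇒m≤o∸n (p + t) p+t+p≤n

    1≤q : 1 ≤ q
    1≤q = ≤-trans 1≤p (≤-trans (m≤m+n p t) p+t≤q)

    module Fooling (tree : Tree n (suc p))
      (approx : ∀ f → IsInstance f → IsPartition (run f tree) ×
        (∀ (T : Vector (Subset n) (suc p)) → IsOptimal f T → cost f (run f tree) ≤ℝ (2ℝ -ℝ ε) *ℝ cost f T)) where

      -- Only the cardinality of `H₀` matters, so hiding from no sets at all supplies one. With a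
      -- zone of radius `pq` the general construction yields `φ` itself, together with the proof
      -- that it is an instance.
      base = hide u t [] threshold
      H₀ : Subset n
      H₀ = proj₁ base
      open Instance H₀ (card H₀ * card (∁ H₀)) public using () renaming (f to f₀; f-isInstance to f₀-isInstance; F-flat to F₀-flat)
      F₀ : Subset n → ℤ
      F₀ = Hard.F H₀ (card H₀ * card (∁ H₀))

      card-∁-of : ∀ (H : Subset n) → card H ≡ p → card (∁ H) ≡ q
      card-∁-of H eq = trans (∣∁p∣≡n∸∣p∣ H) (cong (n ∸_) eq)

      -- With g = pq every deviation lies in [−g, g].
      F₀≡φ : ∀ S → F₀ S ≡ φ p q (+ card S)
      F₀≡φ S = trans
        (F₀-flat {S} (≤-trans (≤-reflexive (*-comm (card (∁ H₀)) _)) (≤-trans (*-monoˡ-≤ (card (∁ H₀)) (∣p∩q∣≤∣q∣ S H₀)) (m≤n+m _ (card H₀ * card (S ∩ ∁ H₀)))))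
                     (≤-trans (*-monoʳ-≤ (card H₀) (∣p∩q∣≤∣q∣ S (∁ H₀))) (m≤n+m _ _)))
        (cong₂ (λ p q → φ p q (+ card S)) (proj₁ (proj₂ base)) (card-∁-of H₀ (proj₁ (proj₂ base))))

      out : Vector (Subset n) (suc p)
      out = run f₀ tree

      Ss : List (Subset n)
      Ss = queried f₀ tree List.++ List.tabulate out

      length-Ss : length Ss ≡ queries f₀ tree + suc p
      length-Ss = trans (List.length-++ (queried f₀ tree))
        (cong₂ _+_ (length-queried f₀ tree) (List.length-tabulate out))

      -- The run on the function with `H` returns `out`, at a cost of at least `lower`, while an
      -- optimum costs no more than the planted partition. The goal is `⊥`, so the doubly negated
      -- existence of an optimum suffices.
      fooled : ∀ (H : Subset n) → card H ≡ p →
        (∀ {S} → S List.∈ Ss → Balanced p (p * (u + t)) H S) → ⊥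
      fooled H cardH balanced = minimum-¬¬ total IsPartition (λ T → sumℤ-nonneg (λ i → F-nonneg (T i)))
        planted planted-part λ where
          (T , T-part , T-min) → Gap.contradictory p q d t (u ∸ t)
            (cong (16 *_) (sym u≡))
            (trans p+q≡n (cong (λ l → p * l + t) L≡))
            (subst (1 ≤_) (sym u≡) 1≤u) 1≤q
            lower≤
            (ℤ.≤-trans (T-min planted planted-part) planted≤)
            (ratio-bound d ε (total out) (total T) (cost f out) (cost f T) 0<η Dη≡1 η≤ε
              (sumℤ-nonneg (λ i → F-nonneg (T i))) (seq-cost F out) (seq-cost F T)
              (subst (λ S → cost f S ≤ℝ (2ℝ -ℝ ε) *ℝ cost f T) out≡
                (proj₂ (approx f f-isInstance) T record
                  { feasible = T-part
                  ; minimal  = λ R R-part → ≤ℝ-pointwise {cost f T} {cost f R} λ m →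
                      subst₂ ℚ._≤_ (sym (seq-cost F T m)) (sym (seq-cost F R m)) (ι-mono (T-min R R-part))
                  })))
        where
        g : ℕ
        g = p * (u + t)
        open Hard H g using (F; F-nonneg; F≤φ; F-hidden)
        open Instance H g using (f; f-isInstance; F-balanced)
        total : Vector (Subset n) (suc p) → ℤ
        total T = sumℤ (λ i → F (T i))
        u≡ : t + (u ∸ t) ≡ u
        u≡ = m+[n∸m]≡n t≤u
        cardH∁ : card (∁ H) ≡ q
        cardH∁ = card-∁-of H cardH
        enum : Enumeration H p
        enum = subst (Enumeration H) cardH (enumerate H)
        open Enumeration enum using (elem)
        open Planted enum
        planted-part : IsPartition planted
        planted-part = planted-isPartition (case nonempty? (∁ H) of λ where
          (yes ne) → ne
          (no emp) → contradiction (subst (1 ≤_) (trans (sym cardH∁) (trans (cong card (Empty-unique emp)) (∣⊥∣≡0 n))) 1≤q) λ ())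
        F≡φ : ∀ {S} → S List.∈ Ss → F S ≡ φ p q (+ card S)
        F≡φ {S} S∈ = trans
          (F-balanced {S} (subst (λ k → n * card (S ∩ H) ≤ k * card S + g) (sym cardH) (proj₁ (balanced S∈)))
                          (subst (λ k → k * card S ≤ n * card (S ∩ H) + g) (sym cardH) (proj₂ (balanced S∈))))
          (cong₂ (λ p q → φ p q (+ card S)) cardH cardH∁)
        out≡ : run f tree ≡ out
        out≡ = run-agree f₀ f tree (λ {S} S∈ → cong toℝ (trans (F₀≡φ S) (sym (F≡φ (List.∈-++⁺ˡ S∈)))))
        lower≤ : Gap.lower p q (+ p ℤ.* + q) ℤ.≤ total out
        lower≤ = ℤ.≤-trans
          (Gap.partition-lower p q out (subst IsPartition out≡ (proj₁ (approx f f-isInstance))) (sym p+q≡n))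
          (ℤ.≤-reflexive (sumℤ-cong (λ i → sym (F≡φ (List.∈-++⁺ʳ (queried f₀ tree) (List.∈-tabulate⁺ {f = out} i))))))
        planted≤ : total planted ℤ.≤ Gap.upper p q (+ (p * (t + (u ∸ t) + t)))
        planted≤ = ℤ.+-mono-≤
          (subst₂ (λ p q → F (∁ H) ℤ.≤ + 2 ℤ.* (+ p ℤ.* + q) ℤ.* + (16 * u * (t + (u ∸ t) + t))) cardH cardH∁
            (subst (λ v → F (∁ H) ℤ.≤ + 2 ℤ.* (+ card H ℤ.* + card (∁ H)) ℤ.* + (p * (v + t))) (sym u≡)
              (F-hidden g≤pq)))
          (sumℤ-≤-const (φ p q 1ℤ) (λ i → subst (F ⁅ elem i ⁆ ℤ.≤_)
            (trans (cong (λ s → φ (card H) (card (∁ H)) (+ s)) (∣⁅x⁆∣≡1 (elem i))) (cong₂ (λ p q → φ p q 1ℤ) cardH cardH∁)) (F≤φ ⁅ elem i ⁆)))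
          where
          g≤pq : + g ℤ.≤ + card H ℤ.* + card (∁ H)
          g≤pq = subst₂ (λ p q → + (16 * u * (u + t)) ℤ.≤ + p ℤ.* + q) (sym cardH) (sym cardH∁)
            (ℤ.≤-trans (ℤ.+≤+ (*-monoʳ-≤ p u+t≤q)) (ℤ.≤-reflexive (ℤ.pos-* p q)))
            where
            u+t≤q : u + t ≤ q
            u+t≤q = ≤-trans (+-monoˡ-≤ t (m≤m+n u _)) p+t≤q

      -- Otherwise some `H` could be hidden. The summand `suc p` counts the returned parts, and the
      -- factor `2` the complements.
      many-queries : suc K ^ (2 * u) ≤ 2 * (queries f₀ tree + suc p) * K ^ (2 * u)
      many-queries = ≮⇒≥ λ few → 
        let H , cardH , balanced = hide u t Ss (subst (λ l → 2 * l * K ^ (2 * u) < suc K ^ (2 * u)) (sym length-Ss) few)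
        in fooled H cardH balanced

-- Exponential growth and uniformity in the ground set

-- One factor `(1 + 1/K)^u` of the square absorbs the linear term `16u + 1`, which leaves
-- `(1 + 1/K)^u ≤ m`. Its `K`-th power gives `2^u ≤ m^K`, because `2 ≤ (1 + 1/K)^K`, and the
-- exponent `16uL + t` is at most `17 L u`.
exponential : ∀ L K .{{_ : NonZero L}} .{{_ : NonZero K}} u t m → t ≤ u → K * (1 + 32 * K) ≤ u →
  suc K ^ (2 * u) ≤ 2 * (m + suc (16 * u)) * K ^ (2 * u) →
  2 ^ (16 * u * L + t) ≤ m ^ (K * (17 * L))
exponential L K u t m t≤u large many = begin
  2 ^ (16 * u * L + t)    ≤⟨ ^-monoʳ-≤ 2 exponent ⟩
  2 ^ (u * (17 * L))      ≡⟨ ^-*-assoc 2 u (17 * L) ⟨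
  (2 ^ u) ^ (17 * L)      ≤⟨ ^-monoˡ-≤ (17 * L) 2^u≤m^K ⟩
  (m ^ K) ^ (17 * L)      ≡⟨ ^-*-assoc m K (17 * L) ⟩
  m ^ (K * (17 * L))      ∎
  where
  open ≤-Reasoning
  x z : ℕ
  x = suc K ^ u
  z = K ^ u
  instance
    z≢0 : NonZero z
    z≢0 = m^n≢0 K u
  exponent : 16 * u * L + t ≤ u * (17 * L)
  exponent = begin
    16 * u * L + t      ≤⟨ +-monoʳ-≤ (16 * u * L) (≤-trans t≤u (m≤m*n u L)) ⟩
    16 * u * L + u * L  ≡⟨ eq u L ⟩
    u * (17 * L)        ∎
    where
    eq : ∀ u L → 16 * u * L + u * L ≡ u * (17 * L)
    eq = solve-∀
  double : ∀ y → y ^ (2 * u) ≡ y ^ u * y ^ u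
  double y = trans (cong (λ e → y ^ (u + e)) (+-identityʳ u)) (^-distribˡ-+-* y u u)
  -- The threshold `K (1 + 32 K)` for `u` is what Bernoulli needs here.
  z-small : (2 + 32 * K) * z ≤ x
  z-small = *-cancelˡ-≤ K (begin
    K * ((2 + 32 * K) * z)        ≡⟨ eq K z ⟩
    (K + K * (1 + 32 * K)) * z    ≤⟨ *-monoˡ-≤ z (+-monoʳ-≤ K large) ⟩
    (K + u) * z                   ≤⟨ pow-lower K u ⟩
    K * x                         ∎)
    where
    eq : ∀ K z → K * ((2 + 32 * K) * z) ≡ (K + K * (1 + 32 * K)) * z
    eq = solve-∀
  -- If `m z < x`, then with `(K + u) z ≤ K x` the right side of `many` falls below
  -- `(2 + 32K) z x ≤ x²`.
  x≤mz : x ≤ m * z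
  x≤mz = ≮⇒≥ λ mz<x → <⇒≱ (begin-strict
    2 * (m + suc (16 * u)) * K ^ (2 * u)           ≡⟨ cong (2 * (m + suc (16 * u)) *_) (double K) ⟩
    2 * (m + suc (16 * u)) * (z * z)               ≡⟨ eq₁ m u z ⟩
    (2 * (m * z) + (2 + 32 * u) * z) * z           <⟨ *-monoˡ-< z (+-mono-<-≤ (*-monoʳ-< 2 mz<x) (begin
        (2 + 32 * u) * z          ≤⟨ *-monoˡ-≤ z (+-monoˡ-≤ (32 * u) 2≤32K) ⟩
        (32 * K + 32 * u) * z     ≡⟨ eq₂ K u z ⟩
        32 * ((K + u) * z)        ≤⟨ *-monoʳ-≤ 32 (pow-lower K u) ⟩
        32 * (K * x)              ∎)) ⟩
    (2 * x + 32 * (K * x)) * z                     ≡⟨ eq₃ K x z ⟩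
    (2 + 32 * K) * z * x                           ≤⟨ *-monoˡ-≤ x z-small ⟩
    x * x                                          ≡⟨ double (suc K) ⟨
    suc K ^ (2 * u)                                ∎) many
    where
    2≤32K : 2 ≤ 32 * K
    2≤32K = ≤-trans (*-monoʳ-≤ 2 (ℕ.>-nonZero⁻¹ K)) (*-monoˡ-≤ K {2} {32} (ℕ.s≤s (ℕ.s≤s ℕ.z≤n)))
    eq₁ : ∀ m u z → 2 * (m + suc (16 * u)) * (z * z) ≡ (2 * (m * z) + (2 + 32 * u) * z) * z
    eq₁ = solve-∀
    eq₂ : ∀ K u z → (32 * K + 32 * u) * z ≡ 32 * ((K + u) * z)
    eq₂ = solve-∀
    eq₃ : ∀ K x z → (2 * x + 32 * (K * x)) * z ≡ (2 + 32 * K) * z * x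
    eq₃ = solve-∀
  2K^K≤ : 2 * K ^ K ≤ suc K ^ K
  2K^K≤ = *-cancelˡ-≤ K (≤-trans (≤-reflexive (eq K (K ^ K))) (pow-lower K K))
    where
    eq : ∀ K y → K * (2 * y) ≡ (K + K) * y
    eq = solve-∀
  swap-^ : ∀ y → (y ^ K) ^ u ≡ (y ^ u) ^ K
  swap-^ y = trans (^-*-assoc y K u) (trans (cong (y ^_) (*-comm K u)) (sym (^-*-assoc y u K)))
  2^u≤m^K : 2 ^ u ≤ m ^ K
  2^u≤m^K = *-cancelʳ-≤ (2 ^ u) (m ^ K) (z ^ K) {{m^n≢0 z K}} (begin
    2 ^ u * z ^ K         ≡⟨ cong (2 ^ u *_) (swap-^ K) ⟨
    2 ^ u * (K ^ K) ^ u   ≡⟨ ^-distribʳ-* u 2 (K ^ K) ⟨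
    (2 * K ^ K) ^ u       ≤⟨ ^-monoˡ-≤ u 2K^K≤ ⟩
    (suc K ^ K) ^ u       ≡⟨ swap-^ (suc K) ⟩
    x ^ K                 ≤⟨ ^-monoˡ-≤ K x≤mz ⟩
    (m * z) ^ K           ≡⟨ ^-distribʳ-* K m z ⟩
    m ^ K * z ^ K         ∎)

-- Both constants are fixed before the algorithm. Division by `16 L` gives `n = 16 u L + t`; the
-- bound on `n` forces `u ≥ U`, and `t < 16 L ≤ K ≤ U` then yields `t ≤ u`. The number of parts is
-- `16 u + 1`.
lower-bound : ∀ d E L K .{{_ : NonZero E}} .{{_ : NonZero L}} .{{_ : NonZero K}} →
  L ≡ 2 * suc d → E ≡ 18 → K ≡ E * L * (E * L) →
  ∀ (ε : ℝ) {η : ℚ} → 0ℚ ℚ.< η → ι (+ suc d) ℚ.* η ≡ 1ℚ → ∃[ N ] (∀ m → N ≤ m → η ℚ.≤ seq ε m) →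
  RequiresExponentiallyManyQueries (Approximates (2ℝ -ℝ ε))
lower-bound d E L K L≡ E≡ K≡ ε 0<η Dη≡1 η≤ε = K * (17 * L) , U * (16 * L) , λ alg approx n n₀≤n →
  let u = n / (16 * L)
      t = n % (16 * L)
      U≤u : U ≤ u
      U≤u = subst (_≤ u) (m*n/n≡m U (16 * L)) (/-mono-≤ n₀≤n (≤-refl {16 * L}))
      t≤u : t ≤ u
      t≤u = ≤-trans (<⇒≤ (m%n<n n (16 * L))) (≤-trans 16L≤K (≤-trans K≤U U≤u))
      1≤u : 1 ≤ u
      1≤u = ≤-trans (ℕ.>-nonZero⁻¹ K) (≤-trans K≤U U≤u)
      n≡ : 16 * u * L + t ≡ n
      n≡ = trans (eq u L t) (sym (m≡m%n+[m/n]*n n (16 * L)))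
  in subst (Goal alg) n≡ (solution alg approx u t U≤u t≤u 1≤u)
  where
  U : ℕ
  U = K * (1 + 32 * K)
  instance
    16L≢0 : NonZero (16 * L)
    16L≢0 = m*n≢0 16 L
    EL≢0 : NonZero (E * L)
    EL≢0 = m*n≢0 E L
  K≤U : K ≤ U
  K≤U = m≤m*n K (1 + 32 * K)
  16L≤K : 16 * L ≤ K
  16L≤K = ≤-trans (*-monoˡ-≤ L (subst (16 ≤_) (sym E≡) (m≤m+n 16 2)))
    (subst (E * L ≤_) (sym K≡) (m≤m*n (E * L) (E * L)))
  eq : ∀ u L t → 16 * u * L + t ≡ t + u * (16 * L)
  eq = solve-∀
  Goal : Algorithm → ℕ → Set
  Goal alg n = ∃[ k ] 1 ≤ k × k ≤ n × ∃[ f ] IsInstance f × 2 ^ n ≤ queries {n} {k} f (alg n k) ^ (K * (17 * L))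
  solution : ∀ alg → Approximates (2ℝ -ℝ ε) alg → ∀ u t → U ≤ u → t ≤ u → 1 ≤ u → Goal alg (16 * u * L + t)
  solution alg approx u t U≤u t≤u 1≤u =
    suc (16 * u) , ℕ.s≤s ℕ.z≤n , k≤n , f₀ , f₀-isInstance ,
    exponential L K u t (queries f₀ tree) t≤u U≤u many-queries
    where
    open Lower d E L K L≡ E≡ K≡ ε 0<η Dη≡1 η≤ε
    open Blocks u t t≤u 1≤u (m^n>0 (suc K) (2 * u))
    k≤n : suc p ≤ n
    k≤n = ≤-trans (+-monoˡ-≤ p (≤-trans 1≤p (m≤m+n p t))) p+t+p≤n
    tree : Tree n (suc p)
    tree = alg n (suc p)
    open Fooling tree (approx n (suc p) (ℕ.s≤s ℕ.z≤n) k≤n)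

theorem1 : ∀ (ε : ℝ) → 0ℝ <ℝ ε →
    RequiresExponentiallyManyQueries (Approximates (2ℝ -ℝ ε))
theorem1 ε (δ , 0<δ , N , δ≤ε) =
  -- Eventually `ε ≥ δ ≥ 1/(d + 1)`, so it is enough to refute the ratio `2 − 1/(d + 1)`, with
  -- blocks of `L = 2 (d + 1)` elements.
  let d , η , 0<η , η≤δ , Dη≡1 = archimedean δ 0<δ
  in lower-bound d 18 (2 * suc d) (18 * (2 * suc d) * (18 * (2 * suc d))) refl refl refl ε 0<η Dη≡1
       (N , λ m N≤m → ℚ.≤-trans η≤δ (ℚ.≤-trans (ℚ.≤-reflexive (sym (ℚ.+-identityˡ δ))) (δ≤ε m N≤m)))
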